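{- There is an algorithm that, given integers $\ell \ge 1$ and $k \geq \ell + 4$ and an $n$-vertex (finite, simple, undirected) graph $G$ as input, computes the number of $k$-element subsets $X \subseteq V(G)$ such that the induced subgraph $G[X]$ is an $\ell$-scorpion, in time $O(\ell \cdot n^{\ell + 3})$.
   Context: Graphs are finite, simple and undirected; $\mathbb{N}=\{1,2,3,\dots\}$. For $\ell\in\mathbb{N}$, an $\ell$-scorpion is a graph $H$ with $|V(H)|\ge \ell+4$ that admits a tuple of pairwise distinct vertices $(b,t_1,\dots,t_\ell,s)\in V(H)^{\ell+2}$ ($b$ is called the body, $t_1,\dots,t_\ell$ the tail, $s$ the sting) such that, writing $Q=\{b,t_1,\dots,t_\ell,s\}$ and calling the vertices in $V(H)\setminus Q$ legs: (i) $H[Q]$ is an induced path from $b$ to $s$ whose vertices in order are $b,t_1,\dots,t_\ell,s$ (i.e. the edges of $H[Q]$ are exactly those between consecutive vertices of this sequence); (ii) $b$ is adjacent to all legs; (iii) $b$ is the only vertex in $Q$ adjacent to legs. Edges between legs are unrestricted. The constant hidden in the $O$-notation is independent of $\ell$, $k$ and $G$. -}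

module Defs where

open import Data.Bool using (Bool; false; T; if_then_else_)
open import Data.Fin using (Fin; zero; suc; toℕ; fromℕ<; remQuot)
open import Data.Fin.Subset using (Subset; inside; outside; ∣_∣)
open import Data.List using (List; length)
open import Data.List.Membership.Propositional using (_∈_)
open import Data.List.Relation.Unary.Unique.Propositional using (Unique)
open import Data.Nat using (ℕ; suc; _+_; _*_; _∸_; _≤_; _≟_; _<?_)
open import Data.Product using (Σ; _×_; proj₁; proj₂)
open import Data.Sum using (_⊎_)
open import Data.Vec using (_∷_)
open import Function.Bundles using (_⇔_)
open import Function.Definitions using (Injective)
open import Relation.Binary.PropositionalEquality using (_≡_; _≢_)
open import Relation.Nullary using (yes; no; does)

record Graph (n : ℕ) : Set where
  field
    adj    : Fin n → Fin n → Bool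
    sym    : ∀ u v → adj u v ≡ adj v u
    irrefl : ∀ v → adj v v ≡ false

  Adj : Fin n → Fin n → Set
  Adj u v = T (adj u v)

-- The increasing enumeration of the elements of X.
element : ∀ {n} (X : Subset n) → Fin ∣ X ∣ → Fin n
element (inside  ∷ X) zero    = zero
element (inside  ∷ X) (suc i) = suc (element X i)
element (outside ∷ X) i       = suc (element X i)

-- The induced subgraph G[X], with its vertices renumbered along `element X`.
_[_] : ∀ {n} → Graph n → (X : Subset n) → Graph ∣ X ∣
G [ X ] = record
  { adj    = λ i j → Graph.adj G (element X i) (element X j)
  ; sym    = λ i j → Graph.sym G (element X i) (element X j)
  ; irrefl = λ i → Graph.irrefl G (element X i)
  }

Consecutive : ∀ {m} → Fin m → Fin m → Set
Consecutive i j = toℕ j ≡ suc (toℕ i) ⊎ toℕ i ≡ suc (toℕ j)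

-- q lists (b , t₁ , … , t_ℓ , s), so the body is q zero.
record IsScorpion (ℓ : ℕ) {m : ℕ} (H : Graph m) : Set where
  open Graph H
  field
    size : ℓ + 4 ≤ m
    q    : Fin (2 + ℓ) → Fin m

  body : Fin m
  body = q zero

  Leg : Fin m → Set
  Leg v = ∀ i → v ≢ q i

  field
    distinct      : Injective _≡_ _≡_ q
    induced-path  : ∀ i j → Adj (q i) (q j) ⇔ Consecutive i j
    body-adj-legs : ∀ v → Leg v → Adj body v
    only-body     : ∀ v → Leg v → ∀ i → Adj (q i) v → i ≡ zero

-- The set { x | P x } is finite with exactly N elements.
HasCardinality : {A : Set} → (A → Set) → ℕ → Set
HasCardinality {A} P N =
  Σ (List A) λ xs → Unique xs × (∀ x → (x ∈ xs) ⇔ P x) × length xs ≡ N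

-- The model of computation is a uniform-cost RAM, presented as while-programs.
-- A program mentions finitely many registers and finitely many arrays, all
-- holding natural numbers.  Every constant, register read, array read,
-- addition, truncated subtraction, write and branch costs one time unit.
-- Multiplication is deliberately not a primitive: at unit cost on unbounded
-- numbers it would make the model unreasonably powerful.

infixl 6 _⊕_ _⊖_
infix  4 _≔_
infixr 3 _⨾_

data Expr : Set where
  lit : ℕ → Expr
  reg : ℕ → Expr
  get : ℕ → Expr → Expr          -- get a e: cell number e of array a
  _⊕_ : Expr → Expr → Expr
  _⊖_ : Expr → Expr → Expr

data Prog : Set where
  skip  : Prog
  _≔_   : ℕ → Expr → Prog
  put   : ℕ → Expr → Expr → Prog -- put a e f: cell number e of array a becomes f
  _⨾_   : Prog → Prog → Prog
  cond  : Expr → Prog → Prog → Prog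
  while : Expr → Prog → Prog

record State : Set where
  constructor ⟪_,_⟫
  field
    regs   : ℕ → ℕ
    arrays : ℕ → ℕ → ℕ

open State public

update : {A : Set} → (ℕ → A) → ℕ → A → ℕ → A
update f x a y = if does (y ≟ x) then a else f y

eval : Expr → State → ℕ
eval (lit n)   σ = n
eval (reg x)   σ = regs σ x
eval (get a e) σ = arrays σ a (eval e σ)
eval (e ⊕ f)   σ = eval e σ + eval f σ
eval (e ⊖ f)   σ = eval e σ ∸ eval f σ

cost : Expr → ℕ
cost (lit n)   = 1
cost (reg x)   = 1
cost (get a e) = suc (cost e)
cost (e ⊕ f)   = suc (cost e + cost f)
cost (e ⊖ f)   = suc (cost e + cost f)

setReg : ℕ → ℕ → State → State
setReg x v σ = ⟪ update (regs σ) x v , arrays σ ⟫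

setCell : ℕ → ℕ → ℕ → State → State
setCell a i v σ = ⟪ regs σ , update (arrays σ) a (update (arrays σ a) i v) ⟫

-- ⟨ p , σ ⟩⇓[ t ] τ : started in σ, p halts in τ after exactly t time units.
-- A test succeeds when its value is nonzero.
data ⟨_,_⟩⇓[_]_ : Prog → State → ℕ → State → Set where
  skip : ∀ {σ} → ⟨ skip , σ ⟩⇓[ 1 ] σ
  assign : ∀ {x e σ} → ⟨ x ≔ e , σ ⟩⇓[ suc (cost e) ] setReg x (eval e σ) σ
  put : ∀ {a e f σ} →
    ⟨ put a e f , σ ⟩⇓[ suc (cost e + cost f) ] setCell a (eval e σ) (eval f σ) σ
  seq : ∀ {p q σ τ υ s t} →
    ⟨ p , σ ⟩⇓[ s ] τ → ⟨ q , τ ⟩⇓[ t ] υ → ⟨ p ⨾ q , σ ⟩⇓[ s + t ] υ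
  cond-true : ∀ {e p q σ τ t} → eval e σ ≢ 0 →
    ⟨ p , σ ⟩⇓[ t ] τ → ⟨ cond e p q , σ ⟩⇓[ suc (cost e + t) ] τ
  cond-false : ∀ {e p q σ τ t} → eval e σ ≡ 0 →
    ⟨ q , σ ⟩⇓[ t ] τ → ⟨ cond e p q , σ ⟩⇓[ suc (cost e + t) ] τ
  while-true : ∀ {e p σ τ υ s t} → eval e σ ≢ 0 →
    ⟨ p , σ ⟩⇓[ s ] τ → ⟨ while e p , τ ⟩⇓[ t ] υ →
    ⟨ while e p , σ ⟩⇓[ suc (cost e + s + t) ] υ
  while-false : ∀ {e p σ} → eval e σ ≡ 0 →
    ⟨ while e p , σ ⟩⇓[ suc (cost e) ] σ

-- Row-major adjacency matrix: cell u * n + v is 1 if u and v are adjacent;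
-- all other cells are 0.
matrix : ∀ {n} → Graph n → ℕ → ℕ
matrix {n} G a with a <? n * n
... | no  _    = 0
... | yes a<n² = let uv = remQuot {n} n (fromℕ< a<n²) in
                 if Graph.adj G (proj₁ uv) (proj₂ uv) then 1 else 0

-- Registers 0, 1, 2 hold n, ℓ, k and array 0 holds the adjacency matrix;
-- everything else is 0.
input : ∀ {n} → ℕ → ℕ → Graph n → State
input {n} ℓ k G = ⟪ inputRegs , inputArrays ⟫
  where
  inputRegs : ℕ → ℕ
  inputRegs 0 = n
  inputRegs 1 = ℓ
  inputRegs 2 = k
  inputRegs _ = 0

  inputArrays : ℕ → ℕ → ℕ
  inputArrays 0       = matrix G
  inputArrays (suc _) = λ _ → 0

output : State → ℕ
output σ = regs σ 0

{-# OPTIONS --safe #-}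

-- Write L = ℓ + 2.  Since ℓ ≥ 1 and there are at least two legs, a scorpion determines its
-- path (b , t₁ , … , t_ℓ , s): the body is the only vertex of degree at least 3 that misses
-- exactly ℓ other vertices, t₁ is the only neighbour of b with a neighbour outside the closed
-- neighbourhood of b, and from there the path is forced.  Hence the scorpions of size k are
-- counted by summing, over all L-tuples inducing a path in G, the binomial coefficient
-- (m choose k − L), where m is the number of vertices adjacent to b and to no other vertex of
-- the tuple.
--
-- If n < k the answer is 0.  Otherwise L ≤ n, so testing a tuple (L² steps) and counting its
-- m (L · n steps) cost O(ℓ · n) for each of the n ^ L tuples.  The tuples are the base-n digit
-- strings of the numbers below n ^ L, read off from tables of quotients and remainders modulo
-- n; the binomial coefficients come from iterated prefix sums.
module Submission where

open import Algebra.Properties.CommutativeSemigroup using (interchange)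
open import Data.Bool using (Bool; true; false; T; not; _∧_; if_then_else_)
open import Data.Bool.Properties using (T-∧)
open import Data.Empty using (⊥; ⊥-elim)
open import Data.Fin using (Fin; zero; suc; toℕ; fromℕ<; inject₁; combine; remQuot)
import Data.Fin.Properties as Fin
open import Data.Fin.Subset using (Subset; inside; outside; ∣_∣)
open import Data.Fin.Subset.Properties using (∣p∣≤n)
open import Data.List using ([]; _∷_; _++_; map)
open import Data.List.Membership.Propositional.Properties using (∈-++⁺ˡ; ∈-++⁺ʳ; ∈-++⁻; ∈-map⁺; ∈-map⁻)
open import Data.List.Properties using (length-++; length-map)
import Data.List.Relation.Unary.All as All
open import Data.List.Relation.Unary.AllPairs using ([]; _∷_)
open import Data.List.Relation.Unary.Any using (here)
import Data.List.Relation.Unary.Unique.Propositional.Properties as Unique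
open import Data.Nat using (ℕ; zero; suc; _+_; _*_; _∸_; _^_; _/_; _%_; _≤_; _<_; z≤n; s≤s; _≟_; _≤?_; _<?_; NonZero; >-nonZero)
open import Data.Nat.DivMod using (m%n<n; m≡m%n+[m/n]*n; [m+kn]%n≡m%n; m<n⇒m%n≡m; m*n%n≡0; +-distrib-/; m<n⇒m/n≡0; m*n/n≡m; 0/n≡0; m/n≤m; m<n*o⇒m/o<n)
open import Data.Nat.Properties
open import Data.Nat.Tactic.RingSolver using (solve-∀)
open import Data.Product using (Σ; ∃-syntax; _×_; _,_; proj₁; proj₂)
open import Data.Sum using (_⊎_; inj₁; inj₂) renaming ([_,_]′ to either)
open import Data.Unit using (⊤; tt)
open import Data.Vec using ([]; _∷_; lookup)
import Data.Vec.Functional as Vector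
open import Data.Vec.Properties using (∷-injectiveʳ)
open import Function using (_∘_)
open import Function.Bundles using (_⇔_; mk⇔; Equivalence)
open import Relation.Binary.PropositionalEquality hiding ([_])
open import Relation.Nullary using (¬_; does; yes; no; contradiction)
open import Relation.Nullary.Decidable using (dec-true; dec-false)
open import Defs

-- Finite sums

sumTo : ℕ → (ℕ → ℕ) → ℕ
sumTo zero    f = 0
sumTo (suc n) f = sumTo n f + f n

sumTo-cong : ∀ n {f g : ℕ → ℕ} → (∀ i → i < n → f i ≡ g i) → sumTo n f ≡ sumTo n g
sumTo-cong zero    f≗g = refl
sumTo-cong (suc n) f≗g = cong₂ _+_ (sumTo-cong n λ i i<n → f≗g i (m≤n⇒m≤1+n i<n)) (f≗g n ≤-refl)

sumTo-const : ∀ n a → sumTo n (λ _ → a) ≡ n * a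
sumTo-const zero    a = refl
sumTo-const (suc n) a = trans (cong (_+ a) (sumTo-const n a)) (+-comm (n * a) a)

sumTo-≤1 : ∀ n {f : ℕ → ℕ} → (∀ i → f i ≤ 1) → sumTo n f ≤ n
sumTo-≤1 zero    f≤1 = z≤n
sumTo-≤1 (suc n) {f} f≤1 = subst (sumTo (suc n) f ≤_) (+-comm n 1) (+-mono-≤ (sumTo-≤1 n f≤1) (f≤1 n))

sumTo-suc : ∀ n f → sumTo (suc n) f ≡ f 0 + sumTo n (f ∘ suc)
sumTo-suc zero    f = sym (+-identityʳ (f 0))
sumTo-suc (suc n) f = trans (cong (_+ f (suc n)) (sumTo-suc n f)) (+-assoc (f 0) (sumTo n (f ∘ suc)) (f (suc n)))

sumTo≡0 : ∀ n {f} → (∀ i → i < n → f i ≡ 0) → sumTo n f ≡ 0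
sumTo≡0 zero    f≡0 = refl
sumTo≡0 (suc n) f≡0 = cong₂ _+_ (sumTo≡0 n λ i i<n → f≡0 i (m≤n⇒m≤1+n i<n)) (f≡0 n ≤-refl)

sumTo≡0⇒ : ∀ n {f} → sumTo n f ≡ 0 → ∀ i → i < n → f i ≡ 0
sumTo≡0⇒ (suc n) {f} e i i<1+n with m≤n⇒m<n∨m≡n (≤-pred i<1+n)
... | inj₁ i<n  = sumTo≡0⇒ n (m+n≡0⇒m≡0 (sumTo n f) e) i i<n
... | inj₂ refl = m+n≡0⇒n≡0 (sumTo n f) e

sumTo-nonzero : ∀ n {f} → sumTo n f ≢ 0 → ∃[ i ] (i < n × f i ≢ 0)
sumTo-nonzero zero    ≢0 = contradiction refl ≢0
sumTo-nonzero (suc n) {f} ≢0 with f n ≟ 0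
... | no fn≢0  = n , ≤-refl , fn≢0
... | yes fn≡0 = let i , i<n , fi≢0 = sumTo-nonzero n (λ e → ≢0 (cong₂ _+_ e fn≡0))
                 in i , m≤n⇒m≤1+n i<n , fi≢0

sumTo-single : ∀ n {f u} → u < n → (∀ i → i < n → i ≢ u → f i ≡ 0) → sumTo n f ≡ f u
sumTo-single (suc n) {f} {u} u<1+n f≡0 with m≤n⇒m<n∨m≡n (≤-pred u<1+n)
... | inj₁ u<n  = trans
  (cong₂ _+_ (sumTo-single n u<n λ i i<n → f≡0 i (m≤n⇒m≤1+n i<n)) (f≡0 n ≤-refl (<⇒≢ u<n ∘ sym)))
  (+-identityʳ (f u))
... | inj₂ refl = cong (_+ f u) (sumTo≡0 n λ i i<n → f≡0 i (m≤n⇒m≤1+n i<n) (<⇒≢ i<n))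

sumTo-+ : ∀ n f g → sumTo n (λ i → f i + g i) ≡ sumTo n f + sumTo n g
sumTo-+ zero    f g = refl
sumTo-+ (suc n) f g = trans (cong (_+ (f n + g n)) (sumTo-+ n f g))
  (interchange +-commutativeSemigroup (sumTo n f) (sumTo n g) (f n) (g n))

sumTo-swap : ∀ m n (f : ℕ → ℕ → ℕ) → sumTo m (λ i → sumTo n (f i)) ≡ sumTo n (λ j → sumTo m (λ i → f i j))
sumTo-swap zero    n f = sym (sumTo≡0 n λ _ _ → refl)
sumTo-swap (suc m) n f = trans (cong (_+ sumTo n (f m)) (sumTo-swap m n f))
  (sym (sumTo-+ n (λ j → sumTo m (λ i → f i j)) (f m)))

-- Program logic

-- A syntactic test with values in `Bool`: on a concrete program it computes, so a side condition
-- `T (keepsReg x p)` becomes `⊤` and is filled in as an implicit argument.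
keepsReg : ℕ → Prog → Bool
keepsReg x skip         = true
keepsReg x (y ≔ _)      = not (does (x ≟ y))
keepsReg x (put _ _ _)  = true
keepsReg x (p ⨾ q)      = keepsReg x p ∧ keepsReg x q
keepsReg x (cond _ p q) = keepsReg x p ∧ keepsReg x q
keepsReg x (while _ p)  = keepsReg x p

keepsArray : ℕ → Prog → Bool
keepsArray a skip         = true
keepsArray a (_ ≔ _)      = true
keepsArray a (put b _ _)  = not (does (a ≟ b))
keepsArray a (p ⨾ q)      = keepsArray a p ∧ keepsArray a q
keepsArray a (cond _ p q) = keepsArray a p ∧ keepsArray a q
keepsArray a (while _ p)  = keepsArray a p

T-∧ˡ : ∀ {x y} → T (x ∧ y) → T x
T-∧ˡ = proj₁ ∘ Equivalence.to T-∧

T-∧ʳ : ∀ {x y} → T (x ∧ y) → T y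
T-∧ʳ {x} = proj₂ ∘ Equivalence.to (T-∧ {x})

update-other : ∀ {A : Set} (f : ℕ → A) x y {v} → T (not (does (y ≟ x))) →
  update f x v y ≡ f y
update-other f x y y≠x with does (y ≟ x)
... | false = refl

update-same : ∀ {A : Set} (f : ℕ → A) x {v} → update f x v x ≡ v
update-same f x {v} = cong (if_then v else f x) (dec-true (x ≟ x) refl)

update-≢ : ∀ {A : Set} (f : ℕ → A) x y {v} → y ≢ x → update f x v y ≡ f y
update-≢ f x y {v} y≢x = cong (if_then v else f y) (dec-false (y ≟ x) y≢x)

-- A relation between states rather than a property of runs: `forRule` needs it between the initial
-- state and a state in the middle of the loop, which no complete run of the loop connects.
record Frame (p : Prog) (σ τ : State) : Set where
  field
    reg-kept   : ∀ x → {T (keepsReg x p)} → regs τ x ≡ regs σ x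
    array-kept : ∀ a → {T (keepsArray a p)} → arrays τ a ≡ arrays σ a

open Frame

frame-reg : ∀ {p σ τ t} → ⟨ p , σ ⟩⇓[ t ] τ → ∀ x → T (keepsReg x p) → regs τ x ≡ regs σ x
frame-reg skip x k = refl
frame-reg {σ = σ} (assign {y}) x k = update-other (regs σ) y x k
frame-reg put x k = refl
frame-reg (seq r s) x k = trans (frame-reg s x (T-∧ʳ k)) (frame-reg r x (T-∧ˡ k))
frame-reg (cond-true _ r) x k = frame-reg r x (T-∧ˡ k)
frame-reg (cond-false _ r) x k = frame-reg r x (T-∧ʳ k)
frame-reg (while-true _ r s) x k = trans (frame-reg s x k) (frame-reg r x k)
frame-reg (while-false _) x k = refl

frame-array : ∀ {p σ τ t} → ⟨ p , σ ⟩⇓[ t ] τ → ∀ a → T (keepsArray a p) → arrays τ a ≡ arrays σ a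
frame-array skip a k = refl
frame-array assign a k = refl
frame-array {σ = σ} (put {b}) a k = update-other (arrays σ) b a k
frame-array (seq r s) a k = trans (frame-array s a (T-∧ʳ k)) (frame-array r a (T-∧ˡ k))
frame-array (cond-true _ r) a k = frame-array r a (T-∧ˡ k)
frame-array (cond-false _ r) a k = frame-array r a (T-∧ʳ k)
frame-array (while-true _ r s) a k = trans (frame-array s a k) (frame-array r a k)
frame-array (while-false _) a k = refl

frame : ∀ {p σ τ t} → ⟨ p , σ ⟩⇓[ t ] τ → Frame p σ τ
frame r = record
  { reg-kept   = λ x {k} → frame-reg r x k
  ; array-kept = λ a {k} → frame-array r a k
  }

-- A total-correctness triple with a time bound. The initial state is a parameter, so `Q` may refer
-- to it.
record Runs (p : Prog) (σ : State) (B : ℕ) (Q : State → Set) : Set where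
  constructor runs
  field
    {time}  : ℕ
    {final} : State
    run     : ⟨ p , σ ⟩⇓[ time ] final
    time≤   : time ≤ B
    post    : Q final

assignRule : ∀ {x e σ Q} → Q (setReg x (eval e σ) σ) → Runs (x ≔ e) σ (suc (cost e)) Q
assignRule = runs assign ≤-refl

-- The frame of the first run is handed to the second premise, so `Q` only has to describe what `p`
-- changes.
seqRule : ∀ {p q σ B C Q R} → Runs p σ B Q →
  (∀ τ → Frame p σ τ → Q τ → Runs q τ C R) → Runs (p ⨾ q) σ (B + C) R
seqRule (runs r r≤ q) k with k _ (frame r) q
... | runs s s≤ post = runs (seq r s) (+-mono-≤ r≤ s≤) post

condTrueRule : ∀ {e p q σ B Q} → eval e σ ≢ 0 → Runs p σ B Q → Runs (cond e p q) σ (suc (cost e + B)) Q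
condTrueRule {e} test (runs r r≤ post) = runs (cond-true test r) (s≤s (+-monoʳ-≤ (cost e) r≤)) post

condFalseRule : ∀ {e p q σ B Q} → eval e σ ≡ 0 → Runs q σ B Q → Runs (cond e p q) σ (suc (cost e + B)) Q
condFalseRule {e} test (runs r r≤ post) = runs (cond-false test r) (s≤s (+-monoʳ-≤ (cost e) r≤)) post

conseq : ∀ {p σ B C Q R} → B ≤ C → (∀ τ → Frame p σ τ → Q τ → R τ) → Runs p σ B Q → Runs p σ C R
conseq B≤C Q⇒R (runs r r≤ q) = runs r (≤-trans r≤ B≤C) (Q⇒R _ (frame r) q)

-- Subtraction is truncated, so the guard is nonzero exactly while the counter x is below y.
for : ℕ → ℕ → Prog → Prog
for x y p = x ≔ lit 0 ⨾ while (reg y ⊖ reg x) (p ⨾ x ≔ reg x ⊕ lit 1)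

-- Each round pays 4 for the test and 4 for the increment on top of the body; the initialization
-- costs 2 and the final test 4.
forTime : ℕ → ℕ → ℕ
forTime N B = N * (B + 8) + 6

-- The invariant receives the round number as an argument and must be insensitive to the counter
-- register; it therefore survives both the initialization and the increments of the counter.
forRule : ∀ {x y p σ N B} (I : ℕ → State → Set) →
  {T (keepsReg x p)} → {T (keepsReg y (for x y p))} →
  regs σ y ≡ N →
  (∀ {i v τ} → I i τ → I i (setReg x v τ)) →
  I 0 σ →
  (∀ i τ → i < N → regs τ x ≡ i → Frame (for x y p) σ τ → I i τ → Runs p τ B (I (suc i))) →
  Runs (for x y p) σ (forTime N B) (I N)
forRule {x} {y} {p} {σ} {N} {B} I {kx} {ky} y≡N stable I0 step = result
  where
  loop : Prog
  loop = while (reg y ⊖ reg x) (p ⨾ x ≔ reg x ⊕ lit 1)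

  next : ∀ {τ τ′ v} → Frame (for x y p) σ τ → Frame p τ τ′ → Frame (for x y p) σ (setReg x v τ′)
  next {τ′ = τ′} f g = record
    { reg-kept = λ z {k} → trans (update-other (regs τ′) x z (T-∧ˡ k))
        (trans (reg-kept g z {T-∧ˡ (T-∧ʳ {not (does (z ≟ x))} k)}) (reg-kept f z {k}))
    ; array-kept = λ a {k} → trans (array-kept g a {T-∧ˡ k}) (array-kept f a {k})
    }

  -- `d` is the number of rounds still to come, which makes the recursion structural.
  iterate : ∀ d i τ → d + i ≡ N → regs τ x ≡ i → Frame (for x y p) σ τ → I i τ →
    Runs loop τ (d * (B + 8) + 4) (I N)
  iterate zero i τ refl x≡i f Ii =
    runs (while-false (trans (cong₂ _∸_ (trans (reg-kept f y {ky}) y≡N) x≡i) (n∸n≡0 i))) ≤-refl Ii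
  iterate (suc d) i τ d+i x≡i f Ii
    with step i τ (subst (suc i ≤_) d+i (s≤s (m≤n+m i d))) x≡i f Ii
  ... | runs {time = s} {final = τ′} r r≤ Isi
    with iterate d (suc i) _ (trans (+-suc d i) d+i)
           (trans (update-same (regs τ′) x) (trans (cong (_+ 1) (trans (frame-reg r x kx) x≡i)) (+-comm i 1)))
           (next f (frame r)) (stable {v = regs τ′ x + 1} Isi)
  ... | runs {time = t} r′ r′≤ post = runs (while-true test (seq r assign) r′) time≤ post
    where
    test : regs τ y ∸ regs τ x ≢ 0
    test e = m<n⇒n≢0 (m<n⇒0<n∸m i<N) (trans (sym (cong₂ _∸_ (trans (reg-kept f y {ky}) y≡N) x≡i)) e)
      where
      i<N : i < N
      i<N = subst (suc i ≤_) d+i (s≤s (m≤n+m i d))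
    time≤ : 4 + (s + 4) + t ≤ (B + 8) + d * (B + 8) + 4
    time≤ = begin
      4 + (s + 4) + t               ≤⟨ +-mono-≤ (+-monoʳ-≤ 4 (+-monoˡ-≤ 4 r≤)) r′≤ ⟩
      4 + (B + 4) + (d * (B + 8) + 4) ≡⟨ cong (_+ (d * (B + 8) + 4)) (trans (+-comm 4 (B + 4)) (+-assoc B 4 4)) ⟩
      (B + 8) + (d * (B + 8) + 4)   ≡⟨ sym (+-assoc (B + 8) (d * (B + 8)) 4) ⟩
      (B + 8) + d * (B + 8) + 4     ∎
      where open ≤-Reasoning

  result : Runs (for x y p) σ (N * (B + 8) + 6) (I N)
  result with iterate N 0 (setReg x 0 σ) (+-identityʳ N) (update-same (regs σ) x)
                (record { reg-kept = λ z {k} → update-other (regs σ) x z (T-∧ˡ k) ; array-kept = λ _ → refl })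
                (stable I0)
  ... | runs {time = t} r r≤ post = runs (seq assign r)
    (subst (2 + t ≤_) (trans (+-comm 2 _) (+-assoc (N * (B + 8)) 4 2)) (+-monoʳ-≤ 2 r≤)) post

sumRule : ∀ {x y p σ N B} (s : ℕ) (F : ℕ → ℕ) →
  {T (keepsReg x p)} → {T (keepsReg y (for x y p))} → {T (not (does (s ≟ x)))} →
  regs σ y ≡ N →
  (∀ i τ → i < N → regs τ x ≡ i → Frame (for x y p) σ τ →
    Runs p τ B (λ υ → regs υ s ≡ regs τ s + F i)) →
  Runs (for x y p) σ (forTime N B) (λ τ → regs τ s ≡ regs σ s + sumTo N F)
sumRule {x} {σ = σ} s F {kx} {ky} {s≠x} y≡N step =
  forRule (λ i τ → regs τ s ≡ regs σ s + sumTo i F) {kx} {ky} y≡N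
    (λ {_} {_} {τ} e → trans (update-other (regs τ) x s s≠x) e) (sym (+-identityʳ _))
    λ i τ i<N x≡i f e → conseq ≤-refl
      (λ υ _ e′ → trans e′ (trans (cong (_+ F i) e) (+-assoc (regs σ s) (sumTo i F) (F i))))
      (step i τ i<N x≡i f)

-- The program and its specification

-- binomial r m = (m choose r), by the hockey-stick identity.
binomial : ℕ → ℕ → ℕ
binomial zero    m = 1
binomial (suc r) m = sumTo m (binomial r)

-- The absolute difference of x and y, since at least one of the truncated differences vanishes.
dist : ℕ → ℕ → ℕ
dist x y = (x ∸ y) + (y ∸ x)

-- 1 if i and j differ by exactly one, and 0 otherwise.
consecutive : ℕ → ℕ → ℕ
consecutive i j = (1 ∸ (dist i j ∸ 1)) ∸ (1 ∸ dist i j)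

-- Vanishes iff the adjacency a of the path vertices x and y at positions i and j is as on a
-- path and x ≡ y happens only for i ≡ j.
mismatch : (a x y i j : ℕ) → ℕ
mismatch a x y i j = dist a (consecutive i j) + ((1 ∸ dist x y) ∸ (1 ∸ dist i j))

-- `1 ∸ i` is 1 for the body at position 0 and 0 for tail and sting: the adjacency that a leg must
-- have to position i.
legMismatch : (a i : ℕ) → ℕ
legMismatch a i = dist a (1 ∸ i)

contribution : ℕ → ℕ → ℕ → ℕ
contribution r zero    m = binomial r m
contribution r (suc _) m = 0

-- Registers: 0 n, 1 ℓ, 2 k, 3 L = ℓ + 2, 4 r = k − L, 5 n ^ L, 6 to 8 loop counters,
-- 9 path defect, 10 leg count, 11 leg defect, 12 total, 13 to 15 scratch.
-- Arrays: 0 adjacency matrix, 1 u ↦ u * n, 2 c ↦ c / n, 3 c ↦ c % n, 4 m ↦ (m choose r),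
-- 5 the current tuple.
rowTable : Prog
rowTable = 13 ≔ lit 0 ⨾ for 6 0 (put 1 (reg 6) (reg 13) ⨾ 13 ≔ reg 13 ⊕ reg 0)

-- One hockey-stick step: prefix sums are formed in place, and register 15 saves each entry before
-- it is overwritten.
scan : Prog
scan = 13 ≔ lit 0 ⨾
  for 6 14 (15 ≔ get 4 (reg 6) ⨾ put 4 (reg 6) (reg 13) ⨾ 13 ≔ reg 13 ⊕ reg 15)

binomialTable : Prog
binomialTable = 14 ≔ reg 0 ⊕ lit 1 ⨾ for 6 14 (put 4 (reg 6) (lit 1)) ⨾ for 7 4 scan

-- In the absence of multiplication, each of the L rounds multiplies by n through n additions.
power : Prog
power = 5 ≔ lit 1 ⨾
  for 7 3 (13 ≔ lit 0 ⨾ for 8 0 (13 ≔ reg 13 ⊕ reg 5) ⨾ 5 ≔ reg 13)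

-- Registers 13 and 14 follow the quotient and the remainder of the loop counter: a remainder that
-- reaches n is reset and carries into the quotient.
divModTables : Prog
divModTables = 13 ≔ lit 0 ⨾ 14 ≔ lit 0 ⨾
  for 6 5 (put 2 (reg 6) (reg 13) ⨾ put 3 (reg 6) (reg 14) ⨾ 14 ≔ reg 14 ⊕ lit 1 ⨾
    cond (reg 0 ⊖ reg 14) skip (14 ≔ lit 0 ⨾ 13 ≔ reg 13 ⊕ lit 1))

decode : Prog
decode = 13 ≔ reg 6 ⨾
  for 7 3 (put 5 (reg 7) (get 3 (reg 13)) ⨾ 13 ≔ get 2 (reg 13))

distE : Expr → Expr → Expr
distE e f = (e ⊖ f) ⊕ (f ⊖ e)

edgeE : Expr → Expr → Expr
edgeE e f = get 0 (get 1 e ⊕ f)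

mismatchE : Expr
mismatchE =
  distE (edgeE (get 5 (reg 7)) (get 5 (reg 8)))
        ((lit 1 ⊖ (distE (reg 7) (reg 8) ⊖ lit 1)) ⊖ (lit 1 ⊖ distE (reg 7) (reg 8)))
  ⊕ ((lit 1 ⊖ distE (get 5 (reg 7)) (get 5 (reg 8))) ⊖ (lit 1 ⊖ distE (reg 7) (reg 8)))

legMismatchE : Expr
legMismatchE = distE (edgeE (get 5 (reg 7)) (reg 8)) (lit 1 ⊖ reg 7)

checkPath : Prog
checkPath = 9 ≔ lit 0 ⨾ for 7 3 (for 8 3 (9 ≔ reg 9 ⊕ mismatchE))

countLegs : Prog
countLegs = 10 ≔ lit 0 ⨾
  for 8 0 (11 ≔ lit 0 ⨾ for 7 3 (11 ≔ reg 11 ⊕ legMismatchE) ⨾ 10 ≔ reg 10 ⊕ (lit 1 ⊖ reg 11))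

processTuple : Prog
processTuple = decode ⨾ checkPath ⨾ countLegs ⨾ cond (reg 9) skip (12 ≔ reg 12 ⊕ get 4 (reg 10))

sumTuples : Prog
sumTuples = 12 ≔ lit 0 ⨾ for 6 5 processTuple

countScorpions : Prog
countScorpions = 3 ≔ lit 2 ⊕ reg 1 ⨾ 4 ≔ reg 2 ⊖ reg 3 ⨾
  rowTable ⨾ binomialTable ⨾ power ⨾ divModTables ⨾ sumTuples ⨾ 0 ≔ reg 12

-- The guard is nonzero exactly when k ≤ n. For ℓ + 4 ≤ k, `countScorpions` then runs only with L
-- and r at most n, on which its time bound relies.
program : Prog
program = cond ((lit 1 ⊕ reg 0) ⊖ reg 2) countScorpions (0 ≔ lit 0)

-- Filling the tables

extendTable : ∀ {f g : ℕ → ℕ} {i x v} → (∀ u → u < i → f u ≡ g u) → x ≡ i → v ≡ g i →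
  ∀ u → u < suc i → update f x v u ≡ g u
extendTable {f} {i = i} f≗g refl refl u u<1+i with u ≟ i
... | yes refl = update-same f i
... | no  u≢i  = trans (update-≢ f i u u≢i) (f≗g u (≤∧≢⇒< (≤-pred u<1+i) u≢i))

rowTable-spec : ∀ {n σ} → regs σ 0 ≡ n →
  Runs rowTable σ (2 + forTime n 7) (λ τ → ∀ u → u < n → arrays τ 1 u ≡ u * n)
rowTable-spec {n} n≡ = seqRule
  (assignRule {Q = λ τ → regs τ 0 ≡ n × regs τ 13 ≡ 0} (n≡ , refl))
  λ τ _ (n≡ , s≡0) → conseq ≤-refl (λ _ _ → proj₂)
    (forRule (λ i υ → regs υ 13 ≡ i * n × (∀ u → u < i → arrays υ 1 u ≡ u * n)) n≡ (λ I → I) (s≡0 , λ _ ())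
      λ i υ _ x≡i f (s≡ , tab) → runs (seq put assign) ≤-refl
        ( trans (cong₂ _+_ s≡ (trans (reg-kept f 0) n≡)) (+-comm (i * n) n)
        , extendTable tab x≡i s≡))

scan-spec : ∀ {N σ} → regs σ 14 ≡ N →
  Runs scan σ (2 + forTime N 10) (λ τ → ∀ m → m < N → arrays τ 4 m ≡ sumTo m (arrays σ 4))
scan-spec {N} {σ} N≡ = seqRule
  (assignRule {Q = λ τ → regs τ 14 ≡ N × regs τ 13 ≡ 0 × arrays τ ≡ arrays σ} (N≡ , refl , refl))
  λ { τ _ (N≡ , s≡0 , a≡) →
  conseq ≤-refl (λ _ _ I → proj₁ (proj₂ I))
    (forRule (λ i υ → regs υ 13 ≡ sumTo i (arrays σ 4)
                    × (∀ m → m < i → arrays υ 4 m ≡ sumTo m (arrays σ 4))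
                    -- The scan is in place, so cells not yet visited must be known to hold their
                    -- old values.
                    × (∀ m → i ≤ m → arrays υ 4 m ≡ arrays σ 4 m))
      N≡ (λ I → I) (s≡0 , (λ _ ()) , λ m _ → cong (λ a → a 4 m) a≡)
      λ i υ _ x≡i _ (s≡ , done , todo) → runs (seq assign (seq put assign)) ≤-refl
        ( cong₂ _+_ s≡ (trans (cong (arrays υ 4) x≡i) (todo i ≤-refl))
        , extendTable done x≡i s≡
        , λ m i<m → trans (update-≢ (arrays υ 4) (regs υ 6) m (λ m≡ → <⇒≢ i<m (sym (trans m≡ x≡i))))
                          (todo m (<⇒≤ i<m)))) }

-- The table has n + 1 entries because it is looked up at numbers of legs, which are bounded by n
-- inclusively.
binomialTable-spec : ∀ {n r σ} → regs σ 0 ≡ n → regs σ 4 ≡ r →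
  Runs binomialTable σ (4 + (forTime (suc n) 3 + forTime r (2 + forTime (suc n) 10)))
    (λ τ → ∀ m → m < suc n → arrays τ 4 m ≡ binomial r m)
binomialTable-spec {n} {r} n≡ r≡ = seqRule
  (assignRule {Q = λ τ → regs τ 14 ≡ suc n × regs τ 4 ≡ r} (trans (cong (_+ 1) n≡) (+-comm n 1) , r≡))
  λ τ _ (N≡ , r≡) → seqRule
    (forRule (λ i υ → ∀ m → m < i → arrays υ 4 m ≡ 1) N≡ (λ I → I) (λ _ ())
      λ i υ _ x≡i _ tab → runs put ≤-refl (extendTable tab x≡i refl))
    λ υ f tab → forRule (λ j φ → ∀ m → m < suc n → arrays φ 4 m ≡ binomial j m)
      (trans (reg-kept f 4) r≡) (λ I → I) tab
      λ j φ _ _ g tab → conseq ≤-refl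
        (λ ψ _ scanned m m<N → trans (scanned m m<N)
          (sumTo-cong m λ i i<m → tab i (<-trans i<m m<N)))
        (scan-spec (trans (reg-kept g 14) (trans (reg-kept f 14) N≡)))

power-spec : ∀ {n L σ} → regs σ 0 ≡ n → regs σ 3 ≡ L →
  Runs power σ (2 + forTime L (2 + (forTime n 4 + 2))) (λ τ → regs τ 5 ≡ n ^ L)
power-spec {n} {L} n≡ L≡ = seqRule
  (assignRule {Q = λ τ → regs τ 0 ≡ n × regs τ 3 ≡ L × regs τ 5 ≡ 1} (n≡ , L≡ , refl))
  λ τ _ (n≡ , L≡ , p≡) → forRule (λ i υ → regs υ 5 ≡ n ^ i) L≡ (λ I → I) p≡
    λ i υ _ _ f p≡ → seqRule
      (assignRule {Q = λ φ → regs φ 0 ≡ n × regs φ 5 ≡ n ^ i × regs φ 13 ≡ 0}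
        (trans (reg-kept f 0) n≡ , p≡ , refl))
      λ φ _ (n≡ , p≡ , s≡0) → seqRule
        (sumRule 13 (λ _ → n ^ i) n≡
          λ _ ψ _ _ g → runs assign ≤-refl (cong (regs ψ 13 +_) (trans (reg-kept g 5) p≡)))
        λ ψ _ s≡ → assignRule (trans s≡ (cong₂ _+_ s≡0 (sumTo-const n (n ^ i))))

divMod-unique : ∀ m d n .{{_ : NonZero n}} → m < n → ((m + d * n) / n ≡ d) × ((m + d * n) % n ≡ m)
divMod-unique m d n m<n = quotient , remainder
  where
  remainder : (m + d * n) % n ≡ m
  remainder = trans ([m+kn]%n≡m%n m d n) (m<n⇒m%n≡m m<n)
  quotient : (m + d * n) / n ≡ d
  quotient = trans
    (+-distrib-/ m (d * n) (subst (_< n)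
      (sym (trans (cong₂ _+_ (m<n⇒m%n≡m m<n) (m*n%n≡0 d n)) (+-identityʳ m))) m<n))
    (cong₂ _+_ (m<n⇒m/n≡0 m<n) (m*n/n≡m d n))

divMod-suc : ∀ c n .{{_ : NonZero n}} → suc (c % n) < n →
  (suc c / n ≡ c / n) × (suc c % n ≡ suc (c % n))
divMod-suc c n m<n = subst (λ e → (suc e / n ≡ c / n) × (suc e % n ≡ suc (c % n)))
  (sym (m≡m%n+[m/n]*n c n)) (divMod-unique (suc (c % n)) (c / n) n m<n)

divMod-wrap : ∀ c n .{{_ : NonZero n}} → suc (c % n) ≡ n →
  (suc c / n ≡ suc (c / n)) × (suc c % n ≡ 0)
divMod-wrap c n m≡n = subst (λ e → (e / n ≡ suc (c / n)) × (e % n ≡ 0))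
  (sym (trans (cong suc (m≡m%n+[m/n]*n c n)) (cong (_+ c / n * n) m≡n)))
  (divMod-unique 0 (suc (c / n)) n (≤-trans (s≤s z≤n) (m%n<n c n)))

divModTables-spec : ∀ {n N σ} .{{_ : NonZero n}} → regs σ 0 ≡ n → regs σ 5 ≡ N →
  Runs divModTables σ (2 + (2 + forTime N 20))
    (λ τ → (∀ c → c < N → arrays τ 2 c ≡ c / n) × (∀ c → c < N → arrays τ 3 c ≡ c % n))
divModTables-spec {n} {N} n≡ N≡ = seqRule
  (assignRule {Q = λ τ → regs τ 0 ≡ n × regs τ 5 ≡ N × regs τ 13 ≡ 0} (n≡ , N≡ , refl))
  λ _ _ (n≡ , N≡ , d≡0) → seqRule
    (assignRule {Q = λ τ → regs τ 0 ≡ n × regs τ 5 ≡ N × regs τ 13 ≡ 0 × regs τ 14 ≡ 0} (n≡ , N≡ , d≡0 , refl))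
    λ σ _ (n≡ , N≡ , d≡0 , m≡0) → conseq ≤-refl (λ _ _ (_ , _ , quots , rems) → quots , rems)
      (forRule Inv N≡ (λ I → I) (trans d≡0 (sym (0/n≡0 n)) , trans m≡0 (sym (m*n%n≡0 0 n)) , (λ _ ()) , λ _ ())
        λ i τ _ x≡i f I → step i τ x≡i (trans (reg-kept f 0) n≡) I)
  where
  Inv : ℕ → State → Set
  Inv i τ = regs τ 13 ≡ i / n × regs τ 14 ≡ i % n
          × (∀ c → c < i → arrays τ 2 c ≡ c / n) × (∀ c → c < i → arrays τ 3 c ≡ c % n)

  step : ∀ i τ → regs τ 6 ≡ i → regs τ 0 ≡ n → Inv i τ → Runs _ τ 20 (Inv (suc i))
  step i τ x≡i n≡ (d≡ , m≡ , quots , rems) with m≤n⇒m<n∨m≡n (m%n<n i n)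
  ... | inj₁ m<n = runs
    (seq put (seq put (seq assign (cond-true
      (λ e → m<n⇒n≢0 (m<n⇒0<n∸m m<n) (trans (sym (cong₂ _∸_ n≡ m+1≡)) e)) skip))))
    (m≤m+n 15 5)
    ( trans d≡ (sym (proj₁ (divMod-suc i n m<n)))
    , trans m+1≡ (sym (proj₂ (divMod-suc i n m<n)))
    , extendTable quots x≡i d≡ , extendTable rems x≡i m≡)
    where
    m+1≡ : regs τ 14 + 1 ≡ suc (i % n)
    m+1≡ = trans (cong (_+ 1) m≡) (+-comm (i % n) 1)
  ... | inj₂ m≡n = runs
    (seq put (seq put (seq assign (cond-false
      (trans (cong₂ _∸_ n≡ (trans (cong (_+ 1) m≡) (trans (+-comm (i % n) 1) m≡n))) (n∸n≡0 n))
      (seq assign assign)))))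
    ≤-refl
    ( trans (cong (_+ 1) d≡) (trans (+-comm (i / n) 1) (sym (proj₁ (divMod-wrap i n m≡n))))
    , sym (proj₂ (divMod-wrap i n m≡n))
    , extendTable quots x≡i d≡ , extendTable rems x≡i m≡)

-- quot n c i = ⌊c / nⁱ⌋, so digit n c i is the i-th base-n digit of c, least significant first.
quot : ∀ n .{{_ : NonZero n}} → ℕ → ℕ → ℕ
quot n c zero    = c
quot n c (suc i) = quot n c i / n

digit : ∀ n .{{_ : NonZero n}} → ℕ → ℕ → ℕ
digit n c i = quot n c i % n

quot≤ : ∀ n .{{_ : NonZero n}} c i → quot n c i ≤ c
quot≤ n c zero    = ≤-refl
quot≤ n c (suc i) = ≤-trans (m/n≤m (quot n c i) n) (quot≤ n c i)

-- Evaluating the tuples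

module Tuples {n : ℕ} .{{_ : NonZero n}} (G : Graph n) (L r : ℕ) where

  edge : ℕ → ℕ → ℕ
  edge u v = matrix G (u * n + v)

  pathDefect : (ℕ → ℕ) → ℕ
  pathDefect q = sumTo L λ i → sumTo L λ j → mismatch (edge (q i) (q j)) (q i) (q j) i j

  legDefect : (ℕ → ℕ) → ℕ → ℕ
  legDefect q v = sumTo L λ i → legMismatch (edge (q i) v) i

  legCount : (ℕ → ℕ) → ℕ
  legCount q = sumTo n λ v → 1 ∸ legDefect q v

  weight : (ℕ → ℕ) → ℕ
  weight q = contribution r (pathDefect q) (legCount q)

  -- The data that preprocessing provides and that stays fixed during the loop over the tuples.
  record Ready (σ : State) : Set where
    field
      n≡     : regs σ 0 ≡ n
      L≡     : regs σ 3 ≡ L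
      N≡     : regs σ 5 ≡ n ^ L
      graph  : arrays σ 0 ≡ matrix G
      rows   : ∀ u → u < n → arrays σ 1 u ≡ u * n
      quots  : ∀ c → c < n ^ L → arrays σ 2 c ≡ c / n
      rems   : ∀ c → c < n ^ L → arrays σ 3 c ≡ c % n
      binoms : ∀ m → m < suc n → arrays σ 4 m ≡ binomial r m

  open Ready

  keepsTables : Prog → Bool
  keepsTables p = (keepsReg 0 p ∧ keepsReg 3 p ∧ keepsReg 5 p) ∧ keepsArray 0 p ∧ keepsArray 1 p
                ∧ keepsArray 2 p ∧ keepsArray 3 p ∧ keepsArray 4 p

  ready-frame : ∀ {p σ τ} → {T (keepsTables p)} → Frame p σ τ → Ready σ → Ready τ
  ready-frame {p} {σ} {τ} {k} f R = go
      (T-∧ˡ kr) (T-∧ˡ kr′) (T-∧ʳ {keepsReg 3 p} kr′)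
      (T-∧ˡ ka) (T-∧ˡ ka₁) (T-∧ˡ ka₂) (T-∧ˡ ka₃) (T-∧ʳ {keepsArray 3 p} ka₃)
    where
    kr = T-∧ˡ {keepsReg 0 p ∧ keepsReg 3 p ∧ keepsReg 5 p} k
    kr′ = T-∧ʳ {keepsReg 0 p} kr
    ka = T-∧ʳ {keepsReg 0 p ∧ keepsReg 3 p ∧ keepsReg 5 p} k
    ka₁ = T-∧ʳ {keepsArray 0 p} ka
    ka₂ = T-∧ʳ {keepsArray 1 p} ka₁
    ka₃ = T-∧ʳ {keepsArray 2 p} ka₂
    go : T (keepsReg 0 p) → T (keepsReg 3 p) → T (keepsReg 5 p) → T (keepsArray 0 p) → T (keepsArray 1 p) →
         T (keepsArray 2 p) → T (keepsArray 3 p) → T (keepsArray 4 p) → Ready τ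
    go r0 r3 r5 a0 a1 a2 a3 a4 = record
      { n≡ = trans (reg-kept f 0 {r0}) (n≡ R)
      ; L≡ = trans (reg-kept f 3 {r3}) (L≡ R)
      ; N≡ = trans (reg-kept f 5 {r5}) (N≡ R)
      ; graph = trans (array-kept f 0 {a0}) (graph R)
      ; rows = λ u u<n → trans (cong (λ h → h u) (array-kept f 1 {a1})) (rows R u u<n)
      ; quots = λ c c<N → trans (cong (λ h → h c) (array-kept f 2 {a2})) (quots R c c<N)
      ; rems = λ c c<N → trans (cong (λ h → h c) (array-kept f 3 {a3})) (rems R c c<N)
      ; binoms = λ m m≤n → trans (cong (λ h → h m) (array-kept f 4 {a4})) (binoms R m m≤n)
      }

  Holds : (ℕ → ℕ) → State → Set
  Holds q σ = ∀ i → i < L → arrays σ 5 i ≡ q i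

  holds-frame : ∀ {p σ τ q} → {T (keepsArray 5 p)} → Frame p σ τ → Holds q σ → Holds q τ
  holds-frame {_} {_} {_} {_} {k} f D i i<L = trans (cong (λ h → h i) (array-kept f 5 {k})) (D i i<L)

  decode-spec : ∀ {c σ} → Ready σ → c < n ^ L → regs σ 6 ≡ c →
    Runs decode σ (2 + forTime L 7) (Holds (digit n c))
  decode-spec {c} R c<N c≡ = seqRule (assignRule {Q = λ τ → regs τ 13 ≡ c} c≡) λ τ f x≡c →
    let R = ready-frame f R in conseq ≤-refl (λ _ _ → proj₂)
      (forRule (λ i υ → regs υ 13 ≡ quot n c i × (∀ j → j < i → arrays υ 5 j ≡ digit n c j))
        (L≡ R) (λ I → I) (x≡c , λ _ ())
        λ i υ _ y≡i g (x≡ , D) →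
          let R = ready-frame g R
              -- Iterated quotients of c never exceed c, so both lookups stay within the tables.
              x<N = ≤-<-trans (quot≤ n c i) c<N
          in runs (seq put assign) ≤-refl
            ( trans (cong (arrays υ 2) x≡) (quots R _ x<N)
            , extendTable D y≡i (trans (cong (arrays υ 3) x≡) (rems R _ x<N))))

  edge-eval : ∀ {σ u x v} → Ready σ → u < n → x ≡ u → arrays σ 0 (arrays σ 1 x + v) ≡ edge u v
  edge-eval {v = v} R u<n refl rewrite graph R = cong (λ a → matrix G (a + v)) (rows R _ u<n)

  module _ {q : ℕ → ℕ} (q<n : ∀ i → q i < n) where

    mismatch-eval : ∀ {σ i j} → Ready σ → Holds q σ → i < L → j < L → regs σ 7 ≡ i → regs σ 8 ≡ j →
      eval mismatchE σ ≡ mismatch (edge (q i) (q j)) (q i) (q j) i j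
    mismatch-eval {σ} R D i<L j<L refl refl =
      cong₂ (λ a (x , y) → mismatch a x y (regs σ 7) (regs σ 8))
        (trans (edge-eval R (q<n _) (D _ i<L)) (cong (edge (q (regs σ 7))) (D _ j<L)))
        (cong₂ _,_ (D _ i<L) (D _ j<L))

    legMismatch-eval : ∀ {σ i v} → Ready σ → Holds q σ → i < L → regs σ 7 ≡ i → regs σ 8 ≡ v →
      eval legMismatchE σ ≡ legMismatch (edge (q i) v) i
    legMismatch-eval {σ} R D i<L refl refl =
      cong (λ a → legMismatch a (regs σ 7)) (edge-eval R (q<n _) (D _ i<L))

    checkPath-spec : ∀ {σ} → Ready σ → Holds q σ →
      Runs checkPath σ (2 + forTime L (forTime L (suc (cost (reg 9 ⊕ mismatchE)))))
        (λ τ → regs τ 9 ≡ pathDefect q)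
    checkPath-spec R D = seqRule (assignRule {Q = λ τ → regs τ 9 ≡ 0} refl) λ τ f s≡0 →
      let R = ready-frame f R ; D = holds-frame f D in
      conseq ≤-refl (λ _ _ s≡ → trans s≡ (cong (_+ pathDefect q) s≡0))
        (sumRule 9 _ (L≡ R) λ i υ i<L x≡i g →
          let R = ready-frame g R ; D = holds-frame g D in
          sumRule 9 _ (L≡ R) λ j φ j<L y≡j h →
            let R = ready-frame h R ; D = holds-frame h D in
            runs assign ≤-refl
              (cong (regs φ 9 +_) (mismatch-eval R D i<L j<L (trans (reg-kept h 7) x≡i) y≡j)))

    countLegs-spec : ∀ {σ} → Ready σ → Holds q σ →
      Runs countLegs σ (2 + forTime n (2 + (forTime L (suc (cost (reg 11 ⊕ legMismatchE))) + 6)))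
        (λ τ → regs τ 10 ≡ legCount q)
    countLegs-spec R D = seqRule (assignRule {Q = λ τ → regs τ 10 ≡ 0} refl) λ τ f s≡0 →
      let R = ready-frame f R ; D = holds-frame f D in
      conseq ≤-refl (λ _ _ s≡ → trans s≡ (cong (_+ legCount q) s≡0))
        (sumRule 10 _ (n≡ R) λ v υ _ y≡v g →
          let R = ready-frame g R ; D = holds-frame g D in
          seqRule (assignRule {Q = λ φ → regs φ 11 ≡ 0 × regs φ 8 ≡ v × regs φ 10 ≡ regs υ 10} (refl , y≡v , refl))
          λ φ h (d≡0 , y≡v , s≡) →
            let R = ready-frame h R ; D = holds-frame h D in
            seqRule
              (sumRule 11 (λ i → legMismatch (edge (q i) v) i) (L≡ R) λ i ψ i<L x≡i k →
                let R = ready-frame k R ; D = holds-frame k D in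
                runs assign ≤-refl
                  (cong (regs ψ 11 +_) (legMismatch-eval R D i<L x≡i (trans (reg-kept k 8) y≡v))))
              λ ψ k d≡ → assignRule
                (cong₂ _+_ (trans (reg-kept k 10) s≡) (cong (1 ∸_) (trans d≡ (cong (_+ legDefect q v) d≡0)))))

  legCount≤n : ∀ q → legCount q ≤ n
  legCount≤n q = sumTo-≤1 n λ v → m∸n≤m 1 (legDefect q v)

  tupleTime : ℕ
  tupleTime = (2 + forTime L 7)
    + ((2 + forTime L (forTime L (suc (cost (reg 9 ⊕ mismatchE)))))
    + ((2 + forTime n (2 + (forTime L (suc (cost (reg 11 ⊕ legMismatchE))) + 6)))
    + 7))

  processTuple-spec : ∀ {c σ} → Ready σ → c < n ^ L → regs σ 6 ≡ c →
    Runs processTuple σ tupleTime (λ τ → regs τ 12 ≡ regs σ 12 + weight (digit n c))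
  processTuple-spec {c} {σ} R c<N c≡ = seqRule (decode-spec R c<N c≡) λ τ f D →
    let R = ready-frame f R in seqRule (checkPath-spec q<n R D) λ υ g bad≡ →
    let R = ready-frame g R ; D = holds-frame g D in seqRule (countLegs-spec q<n R D) λ φ h legs≡ →
    add (ready-frame h R) (trans (reg-kept h 9) bad≡) legs≡
      (trans (reg-kept h 12) (trans (reg-kept g 12) (reg-kept f 12)))
    where
    q = digit n c

    q<n : ∀ i → q i < n
    q<n i = m%n<n (quot n c i) n

    add : ∀ {φ} → Ready φ → regs φ 9 ≡ pathDefect q → regs φ 10 ≡ legCount q → regs φ 12 ≡ regs σ 12 →
      Runs (cond (reg 9) skip (12 ≔ reg 12 ⊕ get 4 (reg 10))) φ 7
        (λ τ → regs τ 12 ≡ regs σ 12 + weight q)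
    add {φ} R bad≡ legs≡ total≡ with pathDefect q
    ... | zero  = runs (cond-false bad≡ assign) ≤-refl
      (cong₂ _+_ total≡ (trans (cong (arrays φ 4) legs≡) (binoms R _ (s≤s (legCount≤n q)))))
    ... | suc _ = runs (cond-true (λ e → 1+n≢0 (trans (sym bad≡) e)) skip) (m≤m+n 3 4)
      (trans total≡ (sym (+-identityʳ _)))

  sumTuples-spec : ∀ {σ} → Ready σ →
    Runs sumTuples σ (2 + forTime (n ^ L) tupleTime)
      (λ τ → regs τ 12 ≡ sumTo (n ^ L) (λ c → weight (digit n c)))
  sumTuples-spec R = seqRule (assignRule {Q = λ τ → regs τ 12 ≡ 0} refl) λ τ f s≡0 →
    let R = ready-frame f R in
    conseq ≤-refl (λ _ _ s≡ → trans s≡ (cong (_+ _) s≡0))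
      (sumRule 12 _ (N≡ R) λ c υ c<N x≡c g → processTuple-spec (ready-frame g R) c<N x≡c)

-- Bracketed exactly as the program rules produce it, so the specification needs no arithmetic on
-- times.
countTime : ∀ n → .{{_ : NonZero n}} → Graph n → ℕ → ℕ → ℕ
countTime n G L r = 4 + (4 + ((2 + forTime n 7)
  + ((4 + (forTime (suc n) 3 + forTime r (2 + forTime (suc n) 10)))
  + ((2 + forTime L (2 + (forTime n 4 + 2)))
  + ((2 + (2 + forTime (n ^ L) 20))
  + ((2 + forTime (n ^ L) (Tuples.tupleTime G L r))
  + 2))))))

countScorpions-spec : ∀ {n} .{{_ : NonZero n}} (ℓ k : ℕ) (G : Graph n) →
  let L = 2 + ℓ ; r = k ∸ L in
  Runs countScorpions (input ℓ k G) (countTime n G L r)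
    (λ τ → output τ ≡ sumTo (n ^ L) (λ c → Tuples.weight G L r (digit n c)))
countScorpions-spec {n} ℓ k G =
  seqRule
    (assignRule {Q = λ τ → regs τ 0 ≡ n × regs τ 2 ≡ k × regs τ 3 ≡ L × arrays τ 0 ≡ matrix G}
      (refl , refl , refl , refl))
  λ { σ₁ _ (n≡ , k≡ , L≡ , g≡) →
  seqRule
    (assignRule {Q = λ τ → regs τ 0 ≡ n × regs τ 3 ≡ L × regs τ 4 ≡ r × arrays τ 0 ≡ matrix G}
      (n≡ , L≡ , cong₂ _∸_ k≡ L≡ , g≡))
  λ { σ₂ _ (n≡₂ , L≡₂ , r≡ , g≡) →
  seqRule (rowTable-spec n≡₂) λ σ₃ f₃ rows →
  let n≡₃ = trans (reg-kept f₃ 0) n≡₂ ; L≡₃ = trans (reg-kept f₃ 3) L≡₂ in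
  seqRule (binomialTable-spec n≡₃ (trans (reg-kept f₃ 4) r≡)) λ σ₄ f₄ binoms →
  let n≡₄ = trans (reg-kept f₄ 0) n≡₃ ; L≡₄ = trans (reg-kept f₄ 3) L≡₃ in
  seqRule (power-spec n≡₄ L≡₄) λ σ₅ f₅ N≡ →
  let n≡₅ = trans (reg-kept f₅ 0) n≡₄ ; L≡₅ = trans (reg-kept f₅ 3) L≡₄ in
  seqRule (divModTables-spec n≡₅ N≡) λ { σ₆ f₆ (quots , rems) →
  seqRule (Tuples.sumTuples-spec G L r {σ = σ₆} (record
    { n≡ = trans (reg-kept f₆ 0) n≡₅
    ; L≡ = trans (reg-kept f₆ 3) L≡₅
    ; N≡ = trans (reg-kept f₆ 5) N≡
    ; graph = trans (array-kept f₆ 0)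
        (trans (array-kept f₅ 0) (trans (array-kept f₄ 0) (trans (array-kept f₃ 0) g≡)))
    ; rows = λ u u<n → trans
        (cong (λ h → h u) (trans (array-kept f₆ 1) (trans (array-kept f₅ 1) (array-kept f₄ 1))))
        (rows u u<n)
    ; quots = quots
    ; rems = rems
    ; binoms = λ m m≤n → trans
        (cong (λ h → h m) (trans (array-kept f₆ 4) (array-kept f₅ 4))) (binoms m m≤n)
    })) λ σ₇ _ total≡ → assignRule total≡ } } }
  where
  L = 2 + ℓ
  r = k ∸ L

-- Running time

-- A record, so that the constant c can be inferred from the shape of the proof.
record _≲[_]_ (t c U : ℕ) : Set where
  constructor bounded
  field
    bound : t ≤ c * U

open _≲[_]_

+-≲ : ∀ {s t c d U} → s ≲[ c ] U → t ≲[ d ] U → (s + t) ≲[ c + d ] U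
+-≲ {c = c} {d} {U} (bounded s≤) (bounded t≤) =
  bounded (≤-trans (+-mono-≤ s≤ t≤) (≤-reflexive (sym (*-distribʳ-+ U c d))))

const-≲ : ∀ c {U} → 1 ≤ U → c ≲[ c ] U
const-≲ c 1≤U = bounded (≤-trans (≤-reflexive (sym (*-identityʳ c))) (*-monoʳ-≤ c 1≤U))

≲-mono : ∀ {s t c U} → s ≤ t → t ≲[ c ] U → s ≲[ c ] U
≲-mono s≤t (bounded t≤) = bounded (≤-trans s≤t t≤)

≲-weaken : ∀ {t c U V} → t ≲[ c ] U → U ≤ V → t ≲[ c ] V
≲-weaken {c = c} (bounded t≤) U≤V = bounded (≤-trans t≤ (*-monoʳ-≤ c U≤V))

≲-scale : ∀ {t c U} a → t ≲[ c ] (a * U) → t ≲[ c * a ] U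
≲-scale {c = c} {U} a (bounded t≤) = bounded (≤-trans t≤ (≤-reflexive (sym (*-assoc c a U))))

unit : ∀ c → c ≲[ c ] 1
unit c = const-≲ c ≤-refl

-- Since N and U are positive, the overhead of 8 per round and 6 per loop is absorbed into N * U,
-- which gives c + 14.
for-≲ : ∀ {N B c U} → 1 ≤ N → 1 ≤ U → B ≲[ c ] U → forTime N B ≲[ c + 14 ] (N * U)
for-≲ {N} {B} {c} {U} 1≤N 1≤U B≲ = bounded (begin
  N * (B + 8) + 6                 ≤⟨ +-mono-≤ (*-monoʳ-≤ N (bound (+-≲ B≲ (const-≲ 8 1≤U))))
                                              (bound (const-≲ 6 (*-mono-≤ 1≤N 1≤U))) ⟩
  N * ((c + 8) * U) + 6 * (N * U) ≡⟨ arrange N c U ⟩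
  (c + 14) * (N * U)              ∎)
  where
  open ≤-Reasoning
  arrange : ∀ N c U → N * ((c + 8) * U) + 6 * (N * U) ≡ (c + 14) * (N * U)
  arrange = solve-∀

-- Each phase is compared with `Z`, the order of the loop over the tuples. The constant stands
-- outside the abstraction over the input, so unification can only solve it by a number independent
-- of ℓ, k and G.
countTime-bound : ∃[ c ] (∀ {n} .{{_ : NonZero n}} (G : Graph n) ℓ k → 1 ≤ ℓ → ℓ + 4 ≤ k → k ≤ n →
  countTime n G (2 + ℓ) (k ∸ (2 + ℓ)) ≲[ c ] (ℓ * n ^ (ℓ + 3)))
countTime-bound = _ , λ {n} G ℓ k 1≤ℓ ℓ+4≤k k≤n → total n G ℓ k 1≤ℓ ℓ+4≤k k≤n
  where
  module _ (n : ℕ) .{{_ : NonZero n}} (G : Graph n) (ℓ k : ℕ)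
           (1≤ℓ : 1 ≤ ℓ) (ℓ+4≤k : ℓ + 4 ≤ k) (k≤n : k ≤ n) where
    L = 2 + ℓ
    r = k ∸ L
    V = n * L
    Z = n ^ L * V

    2+L≤k : 2 + L ≤ k
    2+L≤k = ≤-trans (≤-reflexive (+-comm 4 ℓ)) ℓ+4≤k
    L≤n : L ≤ n
    L≤n = ≤-trans (m≤n+m L 2) (≤-trans 2+L≤k k≤n)
    1≤L : 1 ≤ L
    1≤L = s≤s z≤n
    1≤n : 1 ≤ n
    1≤n = ≤-trans 1≤L L≤n
    1≤r : 1 ≤ r
    1≤r = m<n⇒0<n∸m (≤-trans (s≤s (m≤n+m L 1)) 2+L≤k)
    r≤n : r ≤ n
    r≤n = ≤-trans (m∸n≤m k L) k≤n
    1≤n^L : 1 ≤ n ^ L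
    1≤n^L = m^n>0 n L
    1≤V : 1 ≤ V
    1≤V = *-mono-≤ 1≤n 1≤L
    1≤Z : 1 ≤ Z
    1≤Z = *-mono-≤ 1≤n^L 1≤V
    L≤V : L * 1 ≤ V
    L≤V = ≤-trans (≤-reflexive (*-comm L 1)) (*-monoˡ-≤ L 1≤n)
    V≤Z : V ≤ Z
    V≤Z = ≤-trans (≤-reflexive (sym (*-identityˡ V))) (*-monoˡ-≤ V 1≤n^L)
    n≤Z : n * 1 ≤ Z
    n≤Z = ≤-trans (*-monoʳ-≤ n 1≤L) V≤Z
    n^L≤Z : n ^ L * 1 ≤ Z
    n^L≤Z = *-monoʳ-≤ (n ^ L) 1≤V
    -- Through 1 + n ≤ 2n ≤ Ln ≤ n².
    1+n≤n² : suc n ≤ n * n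
    1+n≤n² = ≤-trans (+-mono-≤ 1≤n (≤-reflexive (sym (+-identityʳ n))))
      (≤-trans (*-monoˡ-≤ n (m≤m+n 2 ℓ)) (*-monoˡ-≤ n L≤n))
    -- The r scans of n + 1 cells are within n * n², and n³ ≤ n ^ L because ℓ ≥ 1 gives L ≥ 3.
    r*[1+n]≤Z : r * (suc n * 1) ≤ Z
    r*[1+n]≤Z = ≤-trans (*-mono-≤ r≤n (*-monoˡ-≤ 1 1+n≤n²))
      (≤-trans (≤-reflexive (cong (n *_) (*-assoc n n 1)))
        (≤-trans (^-monoʳ-≤ n {3} {L} (s≤s (s≤s 1≤ℓ)))
          (≤-trans (≤-reflexive (sym (*-identityʳ (n ^ L)))) n^L≤Z)))
    1+n≤Z : suc n * 1 ≤ Z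
    1+n≤Z = ≤-trans (≤-reflexive (sym (*-identityˡ (suc n * 1))))
      (≤-trans (*-monoˡ-≤ (suc n * 1) 1≤r) r*[1+n]≤Z)

    1≤L*1 : 1 ≤ L * 1
    1≤L*1 = *-mono-≤ 1≤L ≤-refl
    1≤n*1 : 1 ≤ n * 1
    1≤n*1 = *-mono-≤ 1≤n ≤-refl
    1≤1+n : 1 ≤ suc n
    1≤1+n = s≤s z≤n
    1≤[1+n]*1 : 1 ≤ suc n * 1
    1≤[1+n]*1 = s≤s z≤n

    tuple-≲ : Tuples.tupleTime G L r ≲[ _ ] V
    tuple-≲ =
      +-≲ (+-≲ (const-≲ 2 1≤V) (≲-weaken (for-≲ 1≤L ≤-refl (unit 7)) L≤V))
      (+-≲ (+-≲ (const-≲ 2 1≤V)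
        (≲-weaken (for-≲ 1≤L 1≤L*1 (for-≲ 1≤L ≤-refl (unit (suc (cost (reg 9 ⊕ mismatchE))))))
          (*-mono-≤ L≤n (≤-reflexive (*-identityʳ L)))))
      (+-≲ (+-≲ (const-≲ 2 1≤V)
        (≲-weaken (for-≲ 1≤n 1≤L*1
          (+-≲ (const-≲ 2 1≤L*1)
            (+-≲ (for-≲ 1≤L ≤-refl (unit (suc (cost (reg 11 ⊕ legMismatchE))))) (const-≲ 6 1≤L*1))))
          (*-monoʳ-≤ n (≤-reflexive (*-identityʳ L)))))
      (const-≲ 7 1≤V)))

    count-≲ : countTime n G L r ≲[ _ ] Z
    count-≲ =
      +-≲ (const-≲ 4 1≤Z) (+-≲ (const-≲ 4 1≤Z)
      (+-≲ (+-≲ (const-≲ 2 1≤Z) (≲-weaken (for-≲ 1≤n ≤-refl (unit 7)) n≤Z))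
      (+-≲ (+-≲ (const-≲ 4 1≤Z) (+-≲
          (≲-weaken (for-≲ 1≤1+n ≤-refl (unit 3)) 1+n≤Z)
          (≲-weaken (for-≲ 1≤r 1≤[1+n]*1
            (+-≲ (const-≲ 2 1≤[1+n]*1) (for-≲ 1≤1+n ≤-refl (unit 10)))) r*[1+n]≤Z)))
      (+-≲ (+-≲ (const-≲ 2 1≤Z)
          (≲-weaken (for-≲ 1≤L 1≤n*1
            (+-≲ (const-≲ 2 1≤n*1) (+-≲ (for-≲ 1≤n ≤-refl (unit 4)) (const-≲ 2 1≤n*1))))
            (≤-trans (≤-reflexive (trans (cong (L *_) (*-identityʳ n)) (*-comm L n))) V≤Z)))
      (+-≲ (+-≲ (const-≲ 2 1≤Z) (+-≲ (const-≲ 2 1≤Z)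
          (≲-weaken (for-≲ 1≤n^L ≤-refl (unit 20)) n^L≤Z)))
      (+-≲ (+-≲ (const-≲ 2 1≤Z) (for-≲ 1≤n^L 1≤V tuple-≲))
      (const-≲ 2 1≤Z)))))))

    -- The factor 3 comes from L = 2 + ℓ ≤ 3ℓ.
    Z≤ : Z ≤ 3 * (ℓ * n ^ (ℓ + 3))
    Z≤ = begin
      n ^ L * (n * (2 + ℓ))     ≤⟨ *-monoʳ-≤ (n ^ L) (*-monoʳ-≤ n (+-monoˡ-≤ ℓ (*-monoʳ-≤ 2 1≤ℓ))) ⟩
      n ^ L * (n * (2 * ℓ + ℓ)) ≡⟨ arrange (n ^ L) n ℓ ⟩
      3 * (ℓ * (n * n ^ L))     ≡⟨ cong (λ e → 3 * (ℓ * n ^ e)) (+-comm 3 ℓ) ⟩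
      3 * (ℓ * n ^ (ℓ + 3))     ∎
      where
      open ≤-Reasoning
      arrange : ∀ p n ℓ → p * (n * (2 * ℓ + ℓ)) ≡ 3 * (ℓ * (n * p))
      arrange = solve-∀

    total : countTime n G L r ≲[ _ ] (ℓ * n ^ (ℓ + 3))
    total = ≲-scale 3 (≲-weaken count-≲ Z≤)

-- Cardinalities

card-⇔ : ∀ {A : Set} {P Q : A → Set} {N} → (∀ x → P x ⇔ Q x) → HasCardinality P N → HasCardinality Q N
card-⇔ P⇔Q (xs , unique , member , len) = xs , unique
  , (λ x → mk⇔ (Equivalence.to (P⇔Q x) ∘ Equivalence.to (member x))
               (Equivalence.from (member x) ∘ Equivalence.from (P⇔Q x)))
  , len

card-∅ : ∀ {A : Set} {P : A → Set} → (∀ x → ¬ P x) → HasCardinality P 0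
card-∅ ¬P = [] , [] , (λ x → mk⇔ (λ ()) (⊥-elim ∘ ¬P x)) , refl

card-⊎ : ∀ {A : Set} {P Q : A → Set} {M N} → (∀ x → P x → Q x → ⊥) →
  HasCardinality P M → HasCardinality Q N → HasCardinality (λ x → P x ⊎ Q x) (M + N)
card-⊎ disjoint (xs , uxs , mxs , refl) (ys , uys , mys , refl) = xs ++ ys
  , Unique.++⁺ uxs uys (λ { {x} (x∈xs , x∈ys) →
      disjoint x (Equivalence.to (mxs x) x∈xs) (Equivalence.to (mys x) x∈ys) })
  , (λ x → mk⇔ (λ x∈ → either (inj₁ ∘ Equivalence.to (mxs x)) (inj₂ ∘ Equivalence.to (mys x)) (∈-++⁻ xs x∈))
               (either (∈-++⁺ˡ ∘ Equivalence.from (mxs x)) (∈-++⁺ʳ xs ∘ Equivalence.from (mys x))))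
  , length-++ xs

card-sum : ∀ {A : Set} (P : ℕ → A → Set) (F : ℕ → ℕ) N →
  (∀ c d x → c < N → d < N → P c x → P d x → c ≡ d) →
  (∀ c → c < N → HasCardinality (P c) (F c)) →
  HasCardinality (λ x → ∃[ c ] (c < N × P c x)) (sumTo N F)
card-sum P F zero    disjoint card = card-∅ λ { x (c , () , _) }
card-sum P F (suc N) disjoint card = card-⇔
  (λ x → mk⇔ (either (λ { (c , c<N , p) → c , m≤n⇒m≤1+n c<N , p }) (λ p → N , ≤-refl , p)) split)
  (card-⊎ (λ { x (c , c<N , p) p′ → <⇒≢ c<N (disjoint c N x (m≤n⇒m≤1+n c<N) ≤-refl p p′) })
    (card-sum P F N (λ c d x c<N d<N → disjoint c d x (m≤n⇒m≤1+n c<N) (m≤n⇒m≤1+n d<N))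
      (λ c c<N → card c (m≤n⇒m≤1+n c<N)))
    (card N ≤-refl))
  where
  split : ∀ {x} → ∃[ c ] (c < suc N × P c x) → ∃[ c ] (c < N × P c x) ⊎ P N x
  split (c , c<1+N , p) with m≤n⇒m<n∨m≡n (≤-pred c<1+N)
  ... | inj₁ c<N  = inj₁ (c , c<N , p)
  ... | inj₂ refl = inj₂ p

card-map : ∀ {A B : Set} {P : A → Set} {N} (f : A → B) → (∀ {x y} → f x ≡ f y → x ≡ y) →
  HasCardinality P N → HasCardinality (λ y → ∃[ x ] (P x × y ≡ f x)) N
card-map f inj (xs , unique , member , refl) = map f xs , Unique.map⁺ inj unique
  , (λ y → mk⇔ (λ y∈ → let x , x∈ , y≡ = ∈-map⁻ f y∈ in x , Equivalence.to (member x) x∈ , y≡)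
               (λ { (x , p , refl) → ∈-map⁺ f (Equivalence.from (member x) p) }))
  , length-map f xs

card-∷ : ∀ {n M N} {P : Subset (suc n) → Set} →
  HasCardinality (λ X → P (outside ∷ X)) M → HasCardinality (λ X → P (inside ∷ X)) N →
  HasCardinality P (M + N)
card-∷ {P = P} without with′ = card-⇔
  (λ X → mk⇔ (either (λ { (_ , p , refl) → p }) (λ { (_ , p , refl) → p })) (split X))
  (card-⊎ (λ { _ (_ , _ , refl) (_ , _ , ()) }) (card-map (outside ∷_) ∷-injectiveʳ without)
                                                (card-map (inside ∷_) ∷-injectiveʳ with′))
  where
  split : ∀ X → P X →
    (∃[ Y ] (P (outside ∷ Y) × X ≡ outside ∷ Y)) ⊎ (∃[ Y ] (P (inside ∷ Y) × X ≡ inside ∷ Y))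
  split (outside ∷ Y) p = inj₁ (Y , p , refl)
  split (inside  ∷ Y) p = inj₂ (Y , p , refl)

-- For a fixed tuple, path vertices must lie in the chosen set, legs may, and all other vertices
-- never do. This separates the counting of sets from the graph.
data Role : Set where
  must may never : Role

Admits : Role → Bool → Set
Admits must  b = b ≡ inside
Admits may   b = ⊤
Admits never b = b ≡ outside

isMust isMay : Role → ℕ
isMust must  = 1
isMust _     = 0
isMay  may   = 1
isMay  _     = 0

Fits : ∀ {n} → (ℕ → Role) → Subset n → Set
Fits ρ X = ∀ v → Admits (ρ (toℕ v)) (lookup X v)

fits-∷ : ∀ {n ρ b} {X : Subset n} → Admits (ρ 0) b → Fits (ρ ∘ suc) X → Fits ρ (b ∷ X)
fits-∷ a f zero    = a
fits-∷ a f (suc v) = f v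

-- Serves to exclude optional vertices once the mandatory ones already exhaust the prescribed size.
musts≤ : ∀ {n} ρ (X : Subset n) → Fits ρ X → sumTo n (isMust ∘ ρ) ≤ ∣ X ∣
musts≤ ρ [] f = z≤n
musts≤ {suc n} ρ (inside ∷ X) f rewrite sumTo-suc n (isMust ∘ ρ) with ρ 0 | f zero
... | must | _ = s≤s (musts≤ (ρ ∘ suc) X (f ∘ suc))
... | may  | _ = m≤n⇒m≤1+n (musts≤ (ρ ∘ suc) X (f ∘ suc))
musts≤ {suc n} ρ (outside ∷ X) f rewrite sumTo-suc n (isMust ∘ ρ) with ρ 0 | f zero
... | may   | _ = musts≤ (ρ ∘ suc) X (f ∘ suc)
... | never | _ = musts≤ (ρ ∘ suc) X (f ∘ suc)

-- The mandatory vertices are forced and r further ones are chosen among the optional ones.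
-- Splitting on the first vertex gives Pascal's rule, which holds by computation for `binomial`.
card-fits : ∀ n ρ k r → k ≡ sumTo n (isMust ∘ ρ) + r →
  HasCardinality (λ (X : Subset n) → ∣ X ∣ ≡ k × Fits ρ X) (binomial r (sumTo n (isMay ∘ ρ)))
card-fits zero ρ k zero refl = ([] ∷ []) , (All.[] ∷ [])
  , (λ { [] → mk⇔ (λ _ → refl , λ ()) (λ _ → here refl) }) , refl
card-fits zero ρ k (suc r) refl = card-∅ λ { [] (() , _) }
card-fits (suc n) ρ k r k≡ rewrite sumTo-suc n (isMust ∘ ρ) | sumTo-suc n (isMay ∘ ρ) = split r (ρ 0) refl k≡
  where
  m = sumTo n (isMay ∘ ρ ∘ suc)
  M = sumTo n (isMust ∘ ρ ∘ suc)
  admits : ∀ {b b′} → ρ 0 ≡ b → Admits b b′ → Admits (ρ 0) b′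
  admits refl a = a
  admitted : ∀ {b b′} {X : Subset n} → ρ 0 ≡ b → Fits ρ (b′ ∷ X) → Admits b b′
  admitted refl f = f zero
  outer : ∀ {k r b} → ρ 0 ≡ b → Admits b outside → k ≡ M + r →
    HasCardinality (λ (X : Subset n) → ∣ outside ∷ X ∣ ≡ k × Fits ρ (outside ∷ X)) (binomial r m)
  outer {k} {r} e a k≡ = card-⇔
    (λ X → mk⇔ (λ (c , f) → c , fits-∷ {ρ = ρ} (admits e a) f) (λ (c , f) → c , f ∘ suc))
    (card-fits n (ρ ∘ suc) k r k≡)
  inner : ∀ {k r b} → ρ 0 ≡ b → Admits b inside → k ≡ suc (M + r) →
    HasCardinality (λ (X : Subset n) → ∣ inside ∷ X ∣ ≡ k × Fits ρ (inside ∷ X)) (binomial r m)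
  inner {k} {r} e a refl = card-⇔
    (λ X → mk⇔ (λ (c , f) → cong suc c , fits-∷ {ρ = ρ} (admits e a) f)
               (λ (c , f) → suc-injective c , f ∘ suc))
    (card-fits n (ρ ∘ suc) (M + r) r refl)
  split : ∀ r b → ρ 0 ≡ b → k ≡ isMust b + M + r →
    HasCardinality (λ (X : Subset (suc n)) → ∣ X ∣ ≡ k × Fits ρ X) (binomial r (isMay b + m))
  split r must e k≡ = card-∷ (card-∅ λ X (_ , f) → contradiction (admitted e f) λ ()) (inner e refl k≡)
  split r never e k≡ = subst (HasCardinality _) (+-identityʳ _)
    (card-∷ (outer e refl k≡) (card-∅ λ X (_ , f) → contradiction (admitted e f) λ ()))
  -- With r = 0, a set using this optional vertex would have fewer than `M` places left for the `M`
  -- mandatory vertices.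
  split zero may e k≡ = card-∷ {M = 1} (outer {r = 0} e tt k≡) (card-∅ λ X (c , f) →
    <⇒≱ {∣ X ∣} {M} (≤-reflexive (trans c (trans k≡ (+-identityʳ M)))) (musts≤ (ρ ∘ suc) X (f ∘ suc)))
  split (suc r) may e k≡ = card-∷ (outer {r = suc r} e tt k≡) (inner e tt (trans k≡ (+-suc M r)))

-- A scorpion determines its path

-- If f were onto, a choice of preimages would inject `Fin m` into the smaller `Fin a`.
fresh : ∀ {a m} → a < m → (f : Fin a → Fin m) → ∃[ v ] (∀ i → v ≢ f i)
fresh a<m f with Fin.all? (λ v → Fin.any? (λ i → v Fin.≟ f i))
... | yes onto = let i , j , i<j , e = Fin.pigeonhole a<m (proj₁ ∘ onto) in
  contradiction (trans (proj₂ (onto i)) (trans (cong f e) (sym (proj₂ (onto j))))) (Fin.<⇒≢ i<j)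
... | no ¬onto = let v , ¬hit = Fin.¬∀⟶∃¬ _ _ (λ v → Fin.any? (λ i → v Fin.≟ f i)) ¬onto in
  v , λ i v≡ → ¬hit (i , v≡)

-- Two of the three positions lie on the same side of i and hence coincide.
consecutive-two : ∀ {m} {i a b c : Fin m} → Consecutive i a → Consecutive i b → Consecutive i c →
  a ≡ b ⊎ a ≡ c ⊎ b ≡ c
consecutive-two (inj₁ a) (inj₁ b) _        = inj₁ (Fin.toℕ-injective (trans a (sym b)))
consecutive-two (inj₂ a) (inj₂ b) _        = inj₁ (Fin.toℕ-injective (suc-injective (trans (sym a) b)))
consecutive-two (inj₁ a) (inj₂ b) (inj₁ c) = inj₂ (inj₁ (Fin.toℕ-injective (trans a (sym c))))
consecutive-two (inj₁ a) (inj₂ b) (inj₂ c) = inj₂ (inj₂ (Fin.toℕ-injective (suc-injective (trans (sym b) c))))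
consecutive-two (inj₂ a) (inj₁ b) (inj₁ c) = inj₂ (inj₂ (Fin.toℕ-injective (trans b (sym c))))
consecutive-two (inj₂ a) (inj₁ b) (inj₂ c) = inj₂ (inj₁ (Fin.toℕ-injective (suc-injective (trans (sym a) c))))

module _ {m : ℕ} {H : Graph m} where

  open Graph H using (Adj)

  adj-sym : ∀ {u v} → Adj u v → Adj v u
  adj-sym {u} {v} = subst T (Graph.sym H u v)

  module Parts {ℓ : ℕ} (S : IsScorpion ℓ H) where

    open IsScorpion S public

    parts : ∀ v → (∃[ i ] v ≡ q i) ⊎ Leg v
    parts v with Fin.any? (λ i → v Fin.≟ q i)
    ... | yes hit = inj₁ hit
    ... | no ¬hit = inj₂ λ i v≡ → ¬hit (i , v≡)

    -- At least ℓ + 4 vertices exceed the ℓ + 2 path vertices by two; the second leg is fresh for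
    -- the path extended by the first.
    two-legs : ∃[ u ] ∃[ v ] (Leg u × Leg v × u ≢ v)
    two-legs =
      let size′ = subst (_≤ m) (+-comm ℓ 4) size
          u , u-leg = fresh (<⇒≤ size′) q
          v , v-new = fresh size′ (u Vector.∷ q)
      in u , v , u-leg , v-new ∘ suc , v-new zero ∘ sym

    tail-neighbour : ∀ i {v} → Adj (q (suc i)) v → ∃[ j ] (v ≡ q j × Consecutive (suc i) j)
    tail-neighbour i {v} a with parts v
    ... | inj₁ (j , refl) = j , refl , Equivalence.to (induced-path (suc i) j) a
    ... | inj₂ leg        = contradiction (only-body v leg (suc i) a) λ ()

    path-adj : ∀ {i j} → Consecutive i j → Adj (q i) (q j)
    path-adj {i} {j} = Equivalence.from (induced-path i j)

  module _ {ℓ : ℕ} (S S′ : IsScorpion (suc ℓ) H) where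

    private
      module A = Parts S
      module B = Parts S′

    -- The body has three neighbours, a vertex of tail or sting at most two.
    body-not-in-tail : ∀ i → B.body ≢ A.q (suc i)
    body-not-in-tail i b≡ =
      let u , v , u-leg , v-leg , u≢v = B.two-legs
          a , t≡a , ca = neighbour (B.path-adj {zero} {suc zero} (inj₁ refl))
          b , u≡b , cb = neighbour (B.body-adj-legs u u-leg)
          c , v≡c , cc = neighbour (B.body-adj-legs v v-leg)
      in distinct (consecutive-two ca cb cc) t≡a u≡b v≡c u-leg v-leg u≢v
      where
      neighbour : ∀ {v} → Adj B.body v → ∃[ j ] (v ≡ A.q j × Consecutive (suc i) j)
      neighbour {v} a = A.tail-neighbour i (subst (λ b → Adj b v) b≡ a)
      distinct : ∀ {a b c u v} → a ≡ b ⊎ a ≡ c ⊎ b ≡ c →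
        B.q (suc zero) ≡ A.q a → u ≡ A.q b → v ≡ A.q c → B.Leg u → B.Leg v → u ≢ v → ⊥
      distinct (inj₁ refl)        t≡ u≡ v≡ u-leg v-leg u≢v = u-leg (suc zero) (trans u≡ (sym t≡))
      distinct (inj₂ (inj₁ refl)) t≡ u≡ v≡ u-leg v-leg u≢v = v-leg (suc zero) (trans v≡ (sym t≡))
      distinct (inj₂ (inj₂ refl)) t≡ u≡ v≡ u-leg v-leg u≢v = u≢v (trans u≡ (sym v≡))

    -- A leg misses all ℓ + 1 vertices of tail and sting, the body misses only ℓ vertices.
    body-not-leg : ¬ A.Leg B.body
    body-not-leg leg =
      let i , j , i<j , e = Fin.pigeonhole ≤-refl (proj₁ ∘ far) in
      Fin.<⇒≢ i<j (Fin.suc-injective (A.distinct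
        (trans (proj₂ (far i)) (trans (cong (λ j → B.q (suc (suc j))) e) (sym (proj₂ (far j)))))))
      where
      missed : ∀ i → ¬ Adj B.body (A.q (suc i))
      missed i a = contradiction (A.only-body B.body leg (suc i) (adj-sym a)) λ ()
      far : ∀ i → ∃[ j ] A.q (suc i) ≡ B.q (suc (suc j))
      far i with B.parts (A.q (suc i))
      ... | inj₁ (zero , e)          = contradiction (sym e) (leg (suc i))
      ... | inj₁ (suc zero , e)      = contradiction
        (subst (Adj B.body) (sym e) (B.path-adj {zero} {suc zero} (inj₁ refl))) (missed i)
      ... | inj₁ (suc (suc j) , e)   = j , e
      ... | inj₂ leg′                = contradiction (B.body-adj-legs _ leg′) (missed i)

    body-unique : A.body ≡ B.body
    body-unique with A.parts B.body
    ... | inj₁ (zero , e)  = sym e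
    ... | inj₁ (suc i , e) = contradiction e (body-not-in-tail i)
    ... | inj₂ leg         = contradiction leg body-not-leg

    -- Suppose t₁ of `S′` were a leg of `S`. The next path vertex of `S′` is its neighbour, hence
    -- the body or a leg of `S`, and so equal or adjacent to the common body. Neither is possible at
    -- position 2 of an induced path.
    tail-start-unique : A.q (suc zero) ≡ B.q (suc zero)
    tail-start-unique with A.parts (B.q (suc zero))
    ... | inj₁ (j , e) = sym (trans e (cong A.q (next (Equivalence.to (A.induced-path zero j)
            (subst₂ Adj (sym body-unique) e (B.path-adj {zero} {suc zero} (inj₁ refl)))))))
      where
      next : ∀ {j} → Consecutive zero j → j ≡ suc zero
      next (inj₁ e) = Fin.toℕ-injective e
    ... | inj₂ leg with A.parts (B.q (suc (suc zero)))
    ...   | inj₁ (j , e) with A.only-body _ leg j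
              (subst (λ v → Adj v (B.q (suc zero))) e (B.path-adj {suc (suc zero)} {suc zero} (inj₂ refl)))
    ...     | refl = contradiction (B.distinct (trans e body-unique)) λ ()
    tail-start-unique | inj₂ leg | inj₂ leg′ with Equivalence.to (B.induced-path zero (suc (suc zero)))
            (subst (λ b → Adj b (B.q (suc (suc zero)))) body-unique (A.body-adj-legs _ leg′))
    ...     | inj₁ ()
    ...     | inj₂ ()

    -- Induction along the path: the vertex of `S′` at position i + 2 is a neighbour of the common
    -- vertex at i + 1, so in `S` it has position i or i + 2; position i is already taken by an
    -- earlier vertex of `S′`.
    scorpion-unique : ∀ i → A.q i ≡ B.q i
    scorpion-unique i = upTo (toℕ i) i ≤-refl
      where
      -- The bound `d` carries the recursion, which goes back to the two preceding positions through
      -- `inject₁`.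
      upTo : ∀ d i → toℕ i ≤ d → A.q i ≡ B.q i
      upTo d zero _ = body-unique
      upTo d (suc zero) _ = tail-start-unique
      upTo (suc (suc d)) (suc (suc i)) (s≤s (s≤s i≤d)) =
        let p₁ = suc (inject₁ i)
            p₀ = inject₁ (inject₁ i)
            j , e , near = A.tail-neighbour (inject₁ i) (subst (λ v → Adj v (B.q (suc (suc i))))
              (sym (upTo (suc d) p₁ (s≤s (≤-trans (≤-reflexive (Fin.toℕ-inject₁ i)) i≤d))))
              (B.path-adj {p₁} {suc (suc i)} (inj₁ (cong (2 +_) (sym (Fin.toℕ-inject₁ i))))))
            p₀≡i = trans (Fin.toℕ-inject₁ (inject₁ i)) (Fin.toℕ-inject₁ i)
        in go p₀ e near p₀≡i (upTo (suc d) p₀ (m≤n⇒m≤1+n (≤-trans (≤-reflexive p₀≡i) i≤d)))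
        where
        go : ∀ p₀ {j} → B.q (suc (suc i)) ≡ A.q j → Consecutive (suc (inject₁ i)) j →
          toℕ p₀ ≡ toℕ i → A.q p₀ ≡ B.q p₀ → A.q (suc (suc i)) ≡ B.q (suc (suc i))
        go p₀ e (inj₁ j≡) _ _ = sym (trans e (cong A.q (Fin.toℕ-injective
          (trans j≡ (cong (2 +_) (Fin.toℕ-inject₁ i))))))
        go p₀ {j} e (inj₂ ≡j) p₀≡ IH = contradiction
          (trans (cong toℕ (B.distinct (trans e (trans (cong A.q (Fin.toℕ-injective
            (trans (suc-injective (sym ≡j)) (trans (Fin.toℕ-inject₁ i) (sym p₀≡))))) IH)))) p₀≡)
          (m+1+n≢n 1)

-- Tuples as numbers

-- `quot` performs the new division last; induction on the length of a tuple has to divide first.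
quot-suc : ∀ n .{{_ : NonZero n}} c i → quot n c (suc i) ≡ quot n (c / n) i
quot-suc n c zero    = refl
quot-suc n c (suc i) = cong (_/ n) (quot-suc n c i)

digit-suc : ∀ n .{{_ : NonZero n}} c i → digit n c (suc i) ≡ digit n (c / n) i
digit-suc n c i = cong (_% n) (quot-suc n c i)

digit-injective : ∀ n .{{_ : NonZero n}} L {c d} → c < n ^ L → d < n ^ L →
  (∀ (i : Fin L) → digit n c (toℕ i) ≡ digit n d (toℕ i)) → c ≡ d
digit-injective n zero    c<1 d<1 e = trans (n<1⇒n≡0 c<1) (sym (n<1⇒n≡0 d<1))
digit-injective n (suc L) {c} {d} c<N d<N e = begin
  c                   ≡⟨ m≡m%n+[m/n]*n c n ⟩
  c % n + c / n * n   ≡⟨ cong₂ (λ a b → a + b * n) (e zero)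
                          (digit-injective n L (shrink c<N) (shrink d<N)
                            λ i → trans (sym (digit-suc n c (toℕ i))) (trans (e (suc i)) (digit-suc n d (toℕ i)))) ⟩
  d % n + d / n * n   ≡⟨ sym (m≡m%n+[m/n]*n d n) ⟩
  d                   ∎
  where
  open ≡-Reasoning
  shrink : ∀ {c} → c < n ^ suc L → c / n < n ^ L
  shrink {c} c<N = m<n*o⇒m/o<n (subst (c <_) (*-comm n (n ^ L)) c<N)

digit-surjective : ∀ n .{{_ : NonZero n}} L (f : Fin L → Fin n) →
  ∃[ c ] (c < n ^ L × (∀ i → digit n c (toℕ i) ≡ toℕ (f i)))
digit-surjective n zero    f = 0 , ≤-refl , λ ()
digit-surjective n (suc L) f =
  let c , c<N , digits = digit-surjective n L (f ∘ suc)
      quotient , remainder = divMod-unique (toℕ (f zero)) c n (Fin.toℕ<n (f zero))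
  in toℕ (f zero) + c * n
   , (begin-strict
       toℕ (f zero) + c * n <⟨ +-monoˡ-< (c * n) (Fin.toℕ<n (f zero)) ⟩
       suc c * n            ≤⟨ *-monoˡ-≤ n c<N ⟩
       n ^ L * n            ≡⟨ *-comm (n ^ L) n ⟩
       n * n ^ L            ∎)
   , λ { zero → remainder
       ; (suc i) → trans (digit-suc n (toℕ (f zero) + c * n) (toℕ i))
                     (trans (cong (λ d → digit n d (toℕ i)) quotient) (digits i)) }
  where open ≤-Reasoning

-- Induced subgraphs and the adjacency matrix

element-inside : ∀ {n} (X : Subset n) i → lookup X (element X i) ≡ inside
element-inside (inside  ∷ X) zero    = refl
element-inside (inside  ∷ X) (suc i) = element-inside X i
element-inside (outside ∷ X) i       = element-inside X i

element-injective : ∀ {n} (X : Subset n) {i j} → element X i ≡ element X j → i ≡ j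
element-injective (inside  ∷ X) {zero}  {zero}  e = refl
element-injective (inside  ∷ X) {suc i} {suc j} e = cong suc (element-injective X (Fin.suc-injective e))
element-injective (outside ∷ X) e = element-injective X (Fin.suc-injective e)

position : ∀ {n} (X : Subset n) v → lookup X v ≡ inside → ∃[ i ] element X i ≡ v
position (inside  ∷ X) zero    _ = zero , refl
position (inside  ∷ X) (suc v) e = let i , i≡ = position X v e in suc i , cong suc i≡
position (outside ∷ X) (suc v) e = let i , i≡ = position X v e in i , cong suc i≡

bit : Bool → ℕ
bit b = if b then 1 else 0

matrix-edge : ∀ {n} (G : Graph n) u v → matrix G (toℕ u * n + toℕ v) ≡ bit (Graph.adj G u v)
matrix-edge {n} G u v with toℕ u * n + toℕ v <? n * n
... | yes a<n² = cong (λ uv → bit (Graph.adj G (proj₁ uv) (proj₂ uv)))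
  (trans (cong (remQuot n) (Fin.toℕ-injective (trans (Fin.toℕ-fromℕ< a<n²) cell))) (Fin.remQuot-combine u v))
  where
  cell : toℕ u * n + toℕ v ≡ toℕ (combine u v)
  cell = sym (trans (Fin.toℕ-combine u v) (cong (_+ toℕ v) (*-comm n (toℕ u))))
... | no a≮n² = contradiction
  (subst (_< n * n) (trans (Fin.toℕ-combine u v) (cong (_+ toℕ v) (*-comm n (toℕ u))))
    (Fin.toℕ<n (combine u v))) a≮n²

-- The arithmetic tests

dist≡0⇒≡ : ∀ {x y} → dist x y ≡ 0 → x ≡ y
dist≡0⇒≡ {x} {y} e = ≤-antisym (m∸n≡0⇒m≤n (m+n≡0⇒m≡0 (x ∸ y) e)) (m∸n≡0⇒m≤n (m+n≡0⇒n≡0 (x ∸ y) e))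

dist-self : ∀ x → dist x x ≡ 0
dist-self x = cong₂ _+_ (n∸n≡0 x) (n∸n≡0 x)

dist≡1⇒consecutive : ∀ i j → dist i j ≡ 1 → j ≡ suc i ⊎ i ≡ suc j
dist≡1⇒consecutive zero    (suc j) e = inj₁ e
dist≡1⇒consecutive (suc i) zero    e = inj₂ (trans (sym (+-identityʳ (suc i))) e)
dist≡1⇒consecutive (suc i) (suc j) e with dist≡1⇒consecutive i j e
... | inj₁ refl = inj₁ refl
... | inj₂ refl = inj₂ refl

consecutive⇒dist≡1 : ∀ {i j} → j ≡ suc i ⊎ i ≡ suc j → dist i j ≡ 1
consecutive⇒dist≡1 {i} (inj₁ refl) = cong₂ _+_ (m≤n⇒m∸n≡0 (n≤1+n i)) (m+n∸n≡m 1 i)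
consecutive⇒dist≡1 {j = j} (inj₂ refl) = cong₂ _+_ (m+n∸n≡m 1 j) (m≤n⇒m∸n≡0 (n≤1+n j))

consecutive≡1 : ∀ {i j} → j ≡ suc i ⊎ i ≡ suc j → consecutive i j ≡ 1
consecutive≡1 c rewrite consecutive⇒dist≡1 c = refl

consecutive≡0 : ∀ {i j} → ¬ (j ≡ suc i ⊎ i ≡ suc j) → consecutive i j ≡ 0
consecutive≡0 {i} {j} ¬c with dist i j in e
... | 0             = refl
... | 1             = contradiction (dist≡1⇒consecutive i j e) ¬c
... | suc (suc d)   = cong₂ _∸_ (0∸n≡0 d) (0∸n≡0 (suc d))

consecutive-dichotomy : ∀ i j →
  (j ≡ suc i ⊎ i ≡ suc j) × consecutive i j ≡ 1 ⊎ ¬ (j ≡ suc i ⊎ i ≡ suc j) × consecutive i j ≡ 0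
consecutive-dichotomy i j with dist i j ≟ 1
... | yes e = let c = dist≡1⇒consecutive i j e in inj₁ (c , consecutive≡1 c)
... | no ¬e = let ¬c = ¬e ∘ consecutive⇒dist≡1 in inj₂ (¬c , consecutive≡0 ¬c)

bit≡1 : ∀ {b} → T b → bit b ≡ 1
bit≡1 {true} _ = refl

bit≡0 : ∀ {b} → ¬ T b → bit b ≡ 0
bit≡0 {false} _  = refl
bit≡0 {true}  ¬b = contradiction tt ¬b

bit≡1⇒T : ∀ {b} → bit b ≡ 1 → T b
bit≡1⇒T {true} _ = tt

bit≡0⇒¬T : ∀ {b} → bit b ≡ 0 → ¬ T b
bit≡0⇒¬T {false} _ ()

bit≡consecutive : ∀ {b i j} → T b ⇔ (j ≡ suc i ⊎ i ≡ suc j) → bit b ≡ consecutive i j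
bit≡consecutive {b} {i} {j} path with consecutive-dichotomy i j
... | inj₁ (c , c≡1)  = trans (bit≡1 (Equivalence.from path c)) (sym c≡1)
... | inj₂ (¬c , c≡0) = trans (bit≡0 (¬c ∘ Equivalence.to path)) (sym c≡0)

bit≡consecutive⇒ : ∀ {b i j} → bit b ≡ consecutive i j → T b ⇔ (j ≡ suc i ⊎ i ≡ suc j)
bit≡consecutive⇒ {b} {i} {j} e with consecutive-dichotomy i j
... | inj₁ (c , c≡1)  = mk⇔ (λ _ → c) (λ _ → bit≡1⇒T (trans e c≡1))
... | inj₂ (¬c , c≡0) = mk⇔ (λ t → contradiction t (bit≡0⇒¬T (trans e c≡0))) (λ c → contradiction c ¬c)

mismatch≡0 : ∀ {a x y i j} → a ≡ consecutive i j → (x ≡ y → i ≡ j) → mismatch a x y i j ≡ 0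
mismatch≡0 {a} {x} {y} {i} {j} refl inj = cong₂ _+_ (dist-self a) apart
  where
  apart : (1 ∸ dist x y) ∸ (1 ∸ dist i j) ≡ 0
  apart with dist x y in e
  ... | suc d = trans (cong (_∸ (1 ∸ dist i j)) (0∸n≡0 d)) (0∸n≡0 (1 ∸ dist i j))
  ... | zero rewrite inj (dist≡0⇒≡ e) | dist-self j = refl

1∸n≢0⇒n≡0 : ∀ {n} → 1 ∸ n ≢ 0 → n ≡ 0
1∸n≢0⇒n≡0 {zero}  _ = refl
1∸n≢0⇒n≡0 {suc n} e = contradiction (0∸n≡0 n) e

n≢0⇒1∸n≡0 : ∀ {n} → n ≢ 0 → 1 ∸ n ≡ 0
n≢0⇒1∸n≡0 {zero}  e = contradiction refl e
n≢0⇒1∸n≡0 {suc n} _ = 0∸n≡0 n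

∀Fin⇒∀< : ∀ {n} (P : ℕ → Set) → (∀ (i : Fin n) → P (toℕ i)) → ∀ i → i < n → P i
∀Fin⇒∀< P h i i<n = subst P (Fin.toℕ-fromℕ< i<n) (h (fromℕ< i<n))

-- Sets spanned by a fixed tuple

-- The first argument will be the number of occurrences in the tuple and the second the indicator of
-- a leg; membership in the path takes precedence.
role : ℕ → ℕ → Role
role (suc _) _       = must
role zero    (suc _) = may
role zero    zero    = never

role-admits : ∀ {o d b} → (o ≢ 0 → b ≡ inside) → (o ≡ 0 → d ≡ 0 → b ≢ inside) → Admits (role o d) b
role-admits {suc _}                  i _ = i λ ()
role-admits {zero} {suc _}           _ _ = tt
role-admits {zero} {zero} {outside}  _ _ = refl
role-admits {zero} {zero} {inside}   _ o = contradiction refl (o refl refl)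

admits-must : ∀ {o d b} → o ≢ 0 → Admits (role o d) b → b ≡ inside
admits-must {zero}  ≢0 _ = contradiction refl ≢0
admits-must {suc _} _  a = a

admits-inside : ∀ {o d} → Admits (role o d) inside → o ≡ 0 → d ≢ 0
admits-inside {d = zero}  () refl
admits-inside {d = suc _} _  _ = λ ()

module Spanned {n : ℕ} .{{_ : NonZero n}} (G : Graph n) (ℓ r : ℕ) (1≤ℓ : 1 ≤ ℓ)
               (q : ℕ → ℕ) (q<n : ∀ i → q i < n) where

  L = 2 + ℓ
  open Tuples G L r
  open Graph G using (adj)

  -- `1 ∸ dist x y` is the indicator of x = y.
  occurrences : ℕ → ℕ
  occurrences v = sumTo L λ i → 1 ∸ dist (q i) v

  roles : ℕ → Role
  roles v = role (occurrences v) (1 ∸ legDefect q v)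

  occurs : ∀ v → occurrences v ≢ 0 → ∃[ i ] (i < L × q i ≡ v)
  occurs v ≢0 = let i , i<L , e = sumTo-nonzero L ≢0 in i , i<L , dist≡0⇒≡ (1∸n≢0⇒n≡0 e)

  occurrences≢0 : ∀ {i} → i < L → occurrences (q i) ≢ 0
  occurrences≢0 {i} i<L e = contradiction
    (trans (sym (cong (1 ∸_) (dist-self (q i)))) (sumTo≡0⇒ L e i i<L)) λ ()

  module Valid (valid : pathDefect q ≡ 0) where

    entry : ∀ i j → i < L → j < L → mismatch (edge (q i) (q j)) (q i) (q j) i j ≡ 0
    entry i j i<L j<L = sumTo≡0⇒ L (sumTo≡0⇒ L valid i i<L) j j<L

    -- The second summand of `mismatch` would be 1 for equal vertices at distinct positions.
    q-injective : ∀ {i j} → i < L → j < L → q i ≡ q j → i ≡ j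
    q-injective {i} {j} i<L j<L e = dist≡0⇒≡ (1∸n≢0⇒n≡0 λ z → contradiction
      (trans (sym (cong₂ _∸_ (cong (1 ∸_) (trans (cong (λ x → dist x (q j)) e) (dist-self (q j)))) z))
             (m+n≡0⇒n≡0 (dist (edge (q i) (q j)) (consecutive i j)) (entry i j i<L j<L))) λ ())

    edge≡ : ∀ {i j} → i < L → j < L → edge (q i) (q j) ≡ consecutive i j
    edge≡ {i} {j} i<L j<L = dist≡0⇒≡
      (m+n≡0⇒m≡0 (dist (edge (q i) (q j)) (consecutive i j)) (entry i j i<L j<L))

    occurrences≡1 : ∀ {i} → i < L → occurrences (q i) ≡ 1
    occurrences≡1 {i} i<L = trans
      (sumTo-single L i<L λ j j<L j≢i → n≢0⇒1∸n≡0 λ e → j≢i (q-injective j<L i<L (dist≡0⇒≡ e)))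
      (cong (1 ∸_) (dist-self (q i)))

    -- b is not adjacent to itself nor to t₂, …, s, and t₁ is adjacent to the next path vertex.
    path-not-leg : ∀ {i} → i < L → legDefect q (q i) ≢ 0
    path-not-leg {zero} i<L e = contradiction
      (trans (sym (cong (λ a → legMismatch a 0) (edge≡ {0} {0} i<L i<L))) (sumTo≡0⇒ L e 0 i<L)) λ ()
    path-not-leg {suc zero} i<L e = contradiction
      (trans (sym (cong (λ a → legMismatch a 2) (edge≡ {2} {1} 2<L i<L))) (sumTo≡0⇒ L e 2 2<L)) λ ()
      where
      2<L : 2 < L
      2<L = s≤s (s≤s 1≤ℓ)
    path-not-leg {suc (suc i)} i<L e = contradiction
      (trans (sym (cong (λ a → legMismatch a 0) (trans (edge≡ {0} {suc (suc i)} (s≤s z≤n) i<L) apart)))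
             (sumTo≡0⇒ L e 0 (s≤s z≤n))) λ ()
      where
      apart : consecutive 0 (suc (suc i)) ≡ 0
      apart = consecutive≡0 {0} {suc (suc i)} λ { (inj₁ ()) ; (inj₂ ()) }

    -- The precedence of path vertices in `role` loses no legs: path vertices are not legs, and each
    -- occurs exactly once.
    counts : ∀ v → isMust (roles v) ≡ occurrences v × isMay (roles v) ≡ 1 ∸ legDefect q v
    counts v with occurrences v ≟ 0
    ... | yes e rewrite e with legDefect q v
    ...   | zero  = refl , refl
    ...   | suc d rewrite 0∸n≡0 d = refl , refl
    counts v | no ≢0 with occurs v ≢0
    ... | i , i<L , refl rewrite occurrences≡1 i<L = refl , sym (n≢0⇒1∸n≡0 (path-not-leg i<L))

    -- Double counting of incidences between vertices and positions: each position holds exactly one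
    -- vertex.
    musts≡L : sumTo n (isMust ∘ roles) ≡ L
    musts≡L = begin
      sumTo n (isMust ∘ roles)                           ≡⟨ sumTo-cong n (λ v _ → proj₁ (counts v)) ⟩
      sumTo n (λ v → sumTo L (λ i → 1 ∸ dist (q i) v))   ≡⟨ sumTo-swap n L (λ v i → 1 ∸ dist (q i) v) ⟩
      sumTo L (λ i → sumTo n (λ v → 1 ∸ dist (q i) v))   ≡⟨ sumTo-cong L (λ i _ → trans
            (sumTo-single n (q<n i) λ v _ v≢ → n≢0⇒1∸n≡0 λ e → v≢ (sym (dist≡0⇒≡ e)))
            (cong (1 ∸_) (dist-self (q i)))) ⟩
      sumTo L (λ _ → 1)                                  ≡⟨ sumTo-const L 1 ⟩
      L * 1                                              ≡⟨ *-identityʳ L ⟩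
      L                                                  ∎
      where open ≡-Reasoning

    mays≡legs : sumTo n (isMay ∘ roles) ≡ legCount q
    mays≡legs = sumTo-cong n λ v _ → proj₂ (counts v)

  adjacent : ∀ {u} i v → toℕ u ≡ q i → edge (q i) (toℕ v) ≡ bit (adj u v)
  adjacent {u} i v e = trans (cong (λ x → edge x (toℕ v)) (sym e)) (matrix-edge G u v)

  Spans : ℕ → Subset n → Set
  Spans k X = ∣ X ∣ ≡ k × Σ (IsScorpion ℓ (G [ X ])) λ S →
    ∀ i → toℕ (element X (IsScorpion.q S i)) ≡ q (toℕ i)

  module _ {k : ℕ} {X : Subset n} (spans : Spans k X) where

    private
      S  = proj₁ (proj₂ spans)
      q≡ = proj₂ (proj₂ spans)
      open Parts S using (parts) renaming (q to p)
      open IsScorpion S hiding (q)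

    spans⇒valid : pathDefect q ≡ 0
    spans⇒valid =
      sumTo≡0 L (∀Fin⇒∀< (λ i → sumTo L (λ j → mismatch (edge (q i) (q j)) (q i) (q j) i j) ≡ 0) λ i →
      sumTo≡0 L (∀Fin⇒∀< (λ j → mismatch (edge (q (toℕ i)) (q j)) (q (toℕ i)) (q j) (toℕ i) j ≡ 0) λ j →
        mismatch≡0
          (trans (cong (edge (q (toℕ i))) (sym (q≡ j)))
            (trans (adjacent (toℕ i) (element X (p j)) (q≡ i)) (bit≡consecutive (induced-path i j))))
          (λ e → cong toℕ (distinct (element-injective X (Fin.toℕ-injective
            (trans (q≡ i) (trans e (sym (q≡ j))))))))))

    leg⇒legDefect≡0 : ∀ {w} → Leg w → legDefect q (toℕ (element X w)) ≡ 0
    leg⇒legDefect≡0 {w} leg = sumTo≡0 L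
      (∀Fin⇒∀< (λ i → legMismatch (edge (q i) (toℕ (element X w))) i ≡ 0) λ
      { zero    → cong (λ a → legMismatch a 0)
          (trans (adjacent 0 (element X w) (q≡ zero)) (bit≡1 (body-adj-legs w leg)))
      ; (suc i) → cong₂ dist
          (trans (adjacent (suc (toℕ i)) (element X w) (q≡ (suc i)))
                 (bit≡0 λ a → contradiction (only-body w leg (suc i) a) λ ()))
          (0∸n≡0 (toℕ i)) })

    spans⇒fits : Fits roles X
    spans⇒fits v = role-admits on-path excluded
      where
      on-path : occurrences (toℕ v) ≢ 0 → lookup X v ≡ inside
      on-path ≢0 = let i , i<L , e = occurs (toℕ v) ≢0 in
        subst (λ u → lookup X u ≡ inside)
          (Fin.toℕ-injective (trans (trans (q≡ (fromℕ< i<L)) (cong q (Fin.toℕ-fromℕ< i<L))) e))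
          (element-inside X (p (fromℕ< i<L)))
      excluded : occurrences (toℕ v) ≡ 0 → 1 ∸ legDefect q (toℕ v) ≡ 0 → lookup X v ≢ inside
      excluded o≡0 d≡0 v∈X with position X v v∈X
      ... | w , refl with parts w
      ...   | inj₁ (i , refl) = occurrences≢0 (Fin.toℕ<n i) (trans (cong occurrences (sym (q≡ i))) o≡0)
      ...   | inj₂ leg        = contradiction (trans (sym (cong (1 ∸_) (leg⇒legDefect≡0 leg))) d≡0) λ ()

  module _ {k : ℕ} {X : Subset n} (valid : pathDefect q ≡ 0) (size : ℓ + 4 ≤ k)
           (∣X∣≡k : ∣ X ∣ ≡ k) (fits : Fits roles X) where

    open Valid valid

    private
      vertex : Fin L → Fin n
      vertex i = fromℕ< (q<n (toℕ i))

      toℕ-vertex : ∀ i → toℕ (vertex i) ≡ q (toℕ i)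
      toℕ-vertex i = Fin.toℕ-fromℕ< (q<n (toℕ i))

      located : ∀ i → ∃[ w ] element X w ≡ vertex i
      located i = position X (vertex i) (admits-must
        (occurrences≢0 (Fin.toℕ<n i) ∘ trans (cong occurrences (sym (toℕ-vertex i)))) (fits (vertex i)))

      p : Fin L → Fin ∣ X ∣
      p i = proj₁ (located i)

      p≡ : ∀ i → toℕ (element X (p i)) ≡ q (toℕ i)
      p≡ i = trans (cong toℕ (proj₂ (located i))) (toℕ-vertex i)

      -- A member of X off the path cannot have the role `never`, so its leg defect vanishes, term
      -- by term.
      leg-edge : ∀ w → (∀ i → w ≢ p i) → ∀ i → bit (adj (element X (p i)) (element X w)) ≡ 1 ∸ toℕ i
      leg-edge w leg i = trans (sym (adjacent (toℕ i) (element X w) (p≡ i)))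
        (dist≡0⇒≡ (sumTo≡0⇒ L legDefect≡0 (toℕ i) (Fin.toℕ<n i)))
        where
        v = element X w
        admitted : Admits (roles (toℕ v)) inside
        admitted = subst (Admits (roles (toℕ v))) (element-inside X w) (fits v)
        not-on-path : occurrences (toℕ v) ≡ 0
        not-on-path with occurrences (toℕ v) ≟ 0
        ... | yes e = e
        ... | no ≢0 = let i , i<L , e = occurs (toℕ v) ≢0 in contradiction
          (element-injective X (Fin.toℕ-injective
            (sym (trans (p≡ (fromℕ< i<L)) (trans (cong q (Fin.toℕ-fromℕ< i<L)) e)))))
          (leg (fromℕ< i<L))
        legDefect≡0 : legDefect q (toℕ v) ≡ 0
        legDefect≡0 = 1∸n≢0⇒n≡0 (admits-inside admitted not-on-path)

    fits⇒spans : Spans k X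
    fits⇒spans = ∣X∣≡k , record
      { size = subst (ℓ + 4 ≤_) (sym ∣X∣≡k) size
      ; q = p
      ; distinct = λ {i} {j} e → Fin.toℕ-injective (q-injective (Fin.toℕ<n i) (Fin.toℕ<n j)
          (trans (sym (p≡ i)) (trans (cong (toℕ ∘ element X) e) (p≡ j))))
      ; induced-path = λ i j → bit≡consecutive⇒ (trans (sym (adjacent (toℕ i) (element X (p j)) (p≡ i)))
          (trans (cong (edge (q (toℕ i))) (p≡ j)) (edge≡ (Fin.toℕ<n i) (Fin.toℕ<n j))))
      ; body-adj-legs = λ w leg → bit≡1⇒T (leg-edge w leg zero)
      ; only-body = λ { w leg zero _ → refl
                      ; w leg (suc i) a → contradiction a
                          (bit≡0⇒¬T (trans (leg-edge w leg (suc i)) (0∸n≡0 (toℕ i)))) }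
      } , p≡

  -- A tuple with nonzero defect spans no set. For any other, being spanned amounts to fitting
  -- `roles`, where L vertices are mandatory and the optional ones are the legs.
  card-spans : ∀ k → ℓ + 4 ≤ k → k ≡ L + r → HasCardinality (Spans k) (weight q)
  card-spans k size k≡ = go (pathDefect q) refl
    where
    go : ∀ d → pathDefect q ≡ d → HasCardinality (Spans k) (contribution r d (legCount q))
    go (suc d) defect = card-∅ λ X spans → contradiction (trans (sym defect) (spans⇒valid spans)) λ ()
    go zero valid = card-⇔
      (λ X → mk⇔ (λ (∣X∣≡k , fits) → fits⇒spans valid size ∣X∣≡k fits)
                 (λ spans → proj₁ spans , spans⇒fits spans))
      (subst (λ m → HasCardinality (λ X → ∣ X ∣ ≡ k × Fits roles X) (binomial r m)) mays≡legs
        (card-fits n roles k r (trans k≡ (cong (_+ r) (sym musts≡L)))))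
      where open Valid valid

-- Correctness and running time of the program

-- Every scorpion is spanned by some number c because all tuples are digit strings, and by only one
-- because `scorpion-unique` fixes its path. The sum thus counts a disjoint union.
card-scorpions : ∀ {n} .{{_ : NonZero n}} (G : Graph n) ℓ k → 1 ≤ ℓ → ℓ + 4 ≤ k →
  let L = 2 + ℓ in
  HasCardinality (λ (X : Subset n) → ∣ X ∣ ≡ k × IsScorpion ℓ (G [ X ]))
    (sumTo (n ^ L) (λ c → Tuples.weight G L (k ∸ L) (digit n c)))
card-scorpions {n} G (suc ℓ₀) k 1≤ℓ size = card-⇔
  (λ X → mk⇔ (λ (_ , _ , ∣X∣≡k , S , _) → ∣X∣≡k , S)
    (λ (∣X∣≡k , S) → let c , c<N , digits = digit-surjective n L (element X ∘ IsScorpion.q S) in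
      c , c<N , ∣X∣≡k , S , sym ∘ digits))
  (card-sum (λ c → At.Spans c k) (λ c → Tuples.weight G L r (digit n c)) (n ^ L)
    (λ { c d X c<N d<N (_ , S , S≡) (_ , S′ , S′≡) → digit-injective n L c<N d<N λ i →
      trans (sym (S≡ i)) (trans (cong (toℕ ∘ element X) (scorpion-unique S S′ i)) (S′≡ i)) })
    (λ c _ → At.card-spans c k size (sym (m+[n∸m]≡n L≤k))))
  where
  ℓ = suc ℓ₀
  L = 2 + ℓ
  r = k ∸ L
  L≤k : L ≤ k
  L≤k = ≤-trans (≤-trans (m≤n+m L 2) (≤-reflexive (+-comm 4 ℓ))) size
  module At (c : ℕ) = Spanned G ℓ r 1≤ℓ (digit n c) (λ i → m%n<n (quot n c i) n)

Counts : ℕ → ℕ → {n : ℕ} → Graph n → ℕ → Set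
Counts ℓ k {n} G = HasCardinality (λ (X : Subset n) → ∣ X ∣ ≡ k × IsScorpion ℓ (G [ X ]))

conclude : ∀ {p σ B c U} {P : Set} {Q : State → Set} → Runs p σ B Q → (P → B ≲[ c ] U) →
  ∃[ t ] ∃[ τ ] (⟨ p , σ ⟩⇓[ t ] τ × Q τ × (P → t ≤ c * U))
conclude (runs {t} {τ} r r≤ q) B≲ = t , τ , r , q , λ h → ≤-trans r≤ (bound (B≲ h))

1≤ℓ*n^e : ∀ {ℓ n} e → 1 ≤ ℓ → 1 ≤ n → 1 ≤ ℓ * n ^ e
1≤ℓ*n^e {n = n} e 1≤ℓ 1≤n = *-mono-≤ 1≤ℓ (m^n>0 n {{>-nonZero 1≤n}} e)

-- The summand 8 covers the outer conditional: 6 for its test, and 2 for writing 0 when k > n. The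
-- time bound assumes n ≥ 1, since its right-hand side is 0 for n = 0.
program-correct : ∀ {c} →
  (∀ {n} .{{_ : NonZero n}} (G : Graph n) ℓ k → 1 ≤ ℓ → ℓ + 4 ≤ k → k ≤ n →
    countTime n G (2 + ℓ) (k ∸ (2 + ℓ)) ≲[ c ] (ℓ * n ^ (ℓ + 3))) →
  ∀ ℓ k n (G : Graph n) → 1 ≤ ℓ → ℓ + 4 ≤ k →
  ∃[ t ] ∃[ σ ] (⟨ program , input ℓ k G ⟩⇓[ t ] σ × Counts ℓ k G (output σ)
    × (1 ≤ n → t ≤ (8 + c) * (ℓ * n ^ (ℓ + 3))))
program-correct {c} time-≲ ℓ k n G 1≤ℓ size with k ≤? n
... | yes k≤n = conclude
  (condTrueRule (m<n⇒n≢0 (m<n⇒0<n∸m (s≤s k≤n)))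
    (conseq ≤-refl (λ _ _ total≡ → subst (Counts ℓ k G) (sym total≡) (card-scorpions G ℓ k 1≤ℓ size))
      (countScorpions-spec ℓ k G)))
  (λ 1≤n → +-≲ (≲-mono (m≤m+n 6 2) (const-≲ 8 (1≤ℓ*n^e (ℓ + 3) 1≤ℓ 1≤n))) (time-≲ G ℓ k 1≤ℓ size k≤n))
  where
  instance
    n≢0 : NonZero n
    n≢0 = >-nonZero (≤-trans (≤-trans 1≤ℓ (m≤m+n ℓ 4)) (≤-trans size k≤n))
... | no k≰n = conclude
  (condFalseRule (m≤n⇒m∸n≡0 (≰⇒> k≰n))
    (assignRule {Q = λ τ → Counts ℓ k G (output τ)}
      (card-∅ λ X (∣X∣≡k , _) → k≰n (subst (_≤ n) ∣X∣≡k (∣p∣≤n X)))))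
  (λ 1≤n → +-≲ (const-≲ 8 (1≤ℓ*n^e (ℓ + 3) 1≤ℓ 1≤n)) (≲-mono z≤n (const-≲ c (1≤ℓ*n^e (ℓ + 3) 1≤ℓ 1≤n))))

theorem3p3 : ∃[ P ] ∃[ c ] (∀ (ℓ k n : ℕ) (G : Graph n) → 1 ≤ ℓ → ℓ + 4 ≤ k →
    ∃[ t ] ∃[ σ ]
    ( ⟨ P , input ℓ k G ⟩⇓[ t ] σ
    × HasCardinality (λ (X : Subset n) → ∣ X ∣ ≡ k × IsScorpion ℓ (G [ X ])) (output σ)
    × (1 ≤ n → t ≤ c * (ℓ * n ^ (ℓ + 3)))))
theorem3p3 = program , 8 + proj₁ countTime-bound
  , program-correct {proj₁ countTime-bound} (proj₂ countTime-bound)
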